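{- Let $p\ge 5$ be a prime. There does not exist a $(8p^3,\,4p^2+2p+1,\,2p+4,\,2p+2)$-PDS in an Abelian group.
   Context: Let $G$ be a finite Abelian group of order $v$ with identity $e$, and $D\subseteq G$ a subset of size $k$. $D$ is a $(v,k,\lambda,\mu)$-partial difference set (PDS) in $G$ if the expressions $gh^{ -1}$ with $g,h\in D$, $g\neq h$, represent each non-identity element of $D$ exactly $\lambda$ times and each non-identity element of $G$ not in $D$ exactly $\mu$ times. Throughout the paper all PDS considered are regular: $D^{(-1)}=D$ and $e\notin D$. -}

module Defs where

open import Data.Nat using (ℕ)
open import Data.Fin using (Fin; _≟_)
open import Data.Fin.Subset using (Subset; _∈_; _∉_; ∣_∣)
open import Data.Fin.Subset.Properties using (_∈?_)
open import Data.List using (List; length; filter; cartesianProduct; allFin)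
open import Data.Product using (_×_; _,_)
open import Relation.Nullary using (¬_)
open import Relation.Nullary.Decidable using (_×-dec_; ¬?)
open import Relation.Binary.PropositionalEquality using (_≡_)
open import Algebra.Structures using (IsAbelianGroup)

-- A finite Abelian group of order v is represented (up to isomorphism) by a
-- group structure on Fin v with propositional equality.
record FiniteAbelianGroup (v : ℕ) : Set where
  field
    _∙_ : Fin v → Fin v → Fin v
    e   : Fin v
    _⁻¹ : Fin v → Fin v
    isAbelianGroup : IsAbelianGroup _≡_ _∙_ e _⁻¹

module _ {v : ℕ} (G : FiniteAbelianGroup v) where
  open FiniteAbelianGroup G

  Rep : Subset v → Fin v → Fin v × Fin v → Set
  Rep D x (g , h) = g ∈ D × h ∈ D × ¬ (g ≡ h) × (g ∙ (h ⁻¹)) ≡ x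

  repCount : Subset v → Fin v → ℕ
  repCount D x =
    length (filter (λ { (g , h) → (g ∈? D) ×-dec ((h ∈? D) ×-dec (¬? (g ≟ h) ×-dec ((g ∙ (h ⁻¹)) ≟ x))) })
                   (cartesianProduct (allFin v) (allFin v)))

  record IsPDS (D : Subset v) (k λ' μ : ℕ) : Set where
    field
      size    : ∣ D ∣ ≡ k
      inD     : ∀ x → ¬ (x ≡ e) → x ∈ D → repCount D x ≡ λ'
      notInD  : ∀ x → ¬ (x ≡ e) → x ∉ D → repCount D x ≡ μ

  record IsRegularPDS (D : Subset v) (k λ' μ : ℕ) : Set where
    field
      isPDS     : IsPDS D k λ' μ
      inverseClosed : ∀ x → x ∈ D → (x ⁻¹) ∈ D
      identityNotIn : e ∉ D

{-# OPTIONS --safe #-}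
-- Let E = D - 1 in ℤ[G]. The parameters say E² = 4p² + (2p + 2)G.
--
-- For a prime q, raising to the q-th power in (ℤ/q)[G] is the substitution
-- g ↦ g^q. If q does not divide 2p, then E^q ≡ E + cG modulo q, where c ≡ 0 by
-- comparison at the identity; as E has coefficients -1, 0 and 1, this gives
-- E(g^q) = E(g), and then E(g^s) = E(g) for all s prime to 2p. If q = p,
-- then E³ ≡ 0 modulo p, so the coefficients of E over each fibre of g ↦ g^p sum to a
-- multiple of p.
--
-- Write G = A × P with |A| = 8 and |P| = p³, and let x(a) be the sum of E over aP.
-- Then p divides x(a). The (p - 1)-st roots of unity modulo p³ act freely on
-- aP \ {a} and preserve E, so x(a) ≡ E(a) modulo p - 1; hence for a ≠ 1 the number
-- x(a)/p is 0 or 1 modulo p - 1 and |4x(a)/p - (2p + 1)| ≥ 5. But the projection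
-- of E² to ℤ[A] gives Σ (4x(a)/p - (2p + 1))² = 56 < 7 · 25.
module Submission where

open import Defs
open import Algebra.Bundles using (CommutativeSemiring; AbelianGroup)
import Algebra.Construct.Pointwise as Pointwise
open import Algebra.Structures.Biased using (isCommutativeSemiringˡ)
open import Data.Bool using (if_then_else_)
open import Data.Empty using (⊥)
open import Data.Fin using (Fin; zero; suc; toℕ; fromℕ<; _≟_)
open import Data.Fin.Permutation using (Permutation; permutation; _⟨$⟩ʳ_)
open import Data.Fin.Properties using (all?; toℕ-injective; toℕ<n; toℕ-fromℕ<; toℕ-fromℕ; toℕ-inject₁)
open import Data.Fin.Subset as Subset using (Subset; inside; outside; _∈_)
open import Data.Fin.Subset.Properties using (_∈?_)
open import Data.List using ([]; _∷_; length; filter; cartesianProduct; allFin; tabulate; map; _++_)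
open import Data.List.Properties using (map-tabulate; filter-++; length-++)
open import Data.List.Relation.Unary.All using (All; []; _∷_)
open import Data.Nat as ℕ using (ℕ; zero; suc; NonZero)
open import Data.Nat.Combinatorics using (_C_; nCn≡1; nCk≡n!/k![n-k]!; k![n∸k]!∣n!)
open import Data.Nat.Coprimality using (Coprime; coprime-Bézout; coprime-divisor)
import Data.Nat.Divisibility as ℕᵈ
open import Data.Nat.DivMod using (_%_; _/_; m/n*n≡m; m≡m%n+[m/n]*n; m%n<n)
open import Data.Nat.GCD using (module Bézout)
import Data.Nat.ListAction as ℕL
open import Data.Nat.Primality using (Prime; euclidsLemma; prime⇒irreducible; prime⇒nonZero; prime⇒nonTrivial; ¬prime[1]; prime[2])
open import Data.Nat.Primality.Factorisation using (factorise; PrimeFactorisation)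
import Data.Nat.Properties as ℕₚ
import Data.Nat.Tactic.RingSolver as ℕ-Solver
open import Data.Product using (∃; _,_; proj₁; proj₂)
open import Data.Sum using (_⊎_; inj₁; inj₂; [_,_]′)
open import Data.Vec using ([]; _∷_)
open import Data.Vec.Functional using (Vector; init; last)
open import Function using (_∘_)
open import Level using (0ℓ)
open import Relation.Binary.PropositionalEquality as ≡ using (_≡_)
open import Relation.Binary.Structures using (IsEquivalence)
open import Relation.Nullary using (Dec; does; yes; no; ¬_; ¬?; contradiction)
open import Relation.Nullary.Decidable using (_×-dec_)
open import Relation.Unary using (Decidable)

-- No direct decomposition of the group is constructed. The exponent `k = p ^ 6` is 0 modulo `p ^ 3`
-- and 1 modulo 8, so `g ↦ g ^ k` projects onto A; A and P occur only as torsion, and x(a) is a sum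
-- over a fibre of this map. That A has exactly 8 elements rests on a group-ring form of Cauchy's
-- theorem. The scalar 4p² is the square of 2p. For an odd prime q the power E^q is therefore
-- (2p)^(q - 1) E up to a multiple of G, and Fermat's little theorem makes this factor 1 whenever q
-- does not divide 2p. The identity of A is left out of the final bound because E(1) = -1: this
-- permits x(1)/p = p - 2, where 4x(1)/p - (2p + 1) is 2p - 9, hence 1 for p = 5. For the other a
-- the integers nearest to the mean that are 0 or 1 modulo p - 1 are 0, 1, p - 1 and p. The closest
-- is p - 1, at 2p - 5, and the constant 5 is its value at p = 5.

-- Binomial coefficients and the Frobenius map in characteristic `q`.

prime∤! : ∀ {q} → Prime q → ∀ n → n ℕ.< q → ¬ (q ℕᵈ.∣ n ℕ.!)
prime∤! pq zero    n<q q∣1 = ¬prime[1] (≡.subst Prime (ℕᵈ.∣1⇒≡1 q∣1) pq)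
prime∤! pq (suc n) n<q q∣ with euclidsLemma (suc n) (n ℕ.!) pq q∣
... | inj₁ q∣1+n = ℕₚ.<⇒≱ n<q (ℕᵈ.∣⇒≤ q∣1+n)
... | inj₂ q∣n!  = prime∤! pq n (ℕₚ.<-trans (ℕₚ.n<1+n n) n<q) q∣n!

-- The prime divides `q !`, which is the binomial coefficient times two factorials of numbers below
-- `q`, and it divides neither factorial.
prime∣binomial : ∀ {q} → Prime q → ∀ k → suc k ℕ.< q → q ℕᵈ.∣ q C suc k
prime∣binomial {zero}      pq k ()
prime∣binomial {q@(suc r)} pq k 1+k<q =
  [ (λ q∣C → q∣C) , (λ q∣d → contradiction q∣d q∤d) ]′
    (euclidsLemma (q C suc k) d pq (≡.subst (q ℕᵈ.∣_) (≡.sym q!≡C*d) (ℕᵈ.m∣m*n (r ℕ.!))))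
  where
  d = suc k ℕ.! ℕ.* (q ℕ.∸ suc k) ℕ.!
  instance
    d≢0 : NonZero d
    d≢0 = (suc k) ℕₚ.!* (q ℕ.∸ suc k) !≢0
  1+k≤q = ℕₚ.<⇒≤ 1+k<q
  q!≡C*d : (q C suc k) ℕ.* d ≡ q ℕ.!
  q!≡C*d = ≡.trans (≡.cong (ℕ._* d) (nCk≡n!/k![n-k]! 1+k≤q)) (m/n*n≡m (k![n∸k]!∣n! 1+k≤q))
  q∤d : ¬ (q ℕᵈ.∣ d)
  q∤d q∣d with euclidsLemma (suc k ℕ.!) ((q ℕ.∸ suc k) ℕ.!) pq q∣d
  ... | inj₁ q∣k! = prime∤! pq (suc k) 1+k<q q∣k!
  ... | inj₂ q∣l! = prime∤! pq (q ℕ.∸ suc k) (ℕₚ.∸-monoʳ-< (ℕ.s≤s ℕ.z≤n) 1+k≤q) q∣l!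

module FreshmansDream {c ℓ} (S : CommutativeSemiring c ℓ) where
  open CommutativeSemiring S hiding (zero)
  open import Algebra.Properties.Semiring.Sum semiring
  open import Algebra.Properties.Semiring.Mult semiring using (_×_; ×-assocˡ; ×-homo-1)
  open import Algebra.Properties.Semiring.Exp semiring using (_^_)
  open import Algebra.Properties.CommutativeSemiring.Binomial S using (theorem; binomialTerm)
  open import Relation.Binary.Reasoning.Setoid setoid

  module _ {q : ℕ} (prime-q : Prime q) (char-q : ∀ x → q × x ≈ 0#) where

    q∣n⇒n×x≈0 : ∀ {n} x → q ℕᵈ.∣ n → n × x ≈ 0#
    q∣n⇒n×x≈0 x (ℕᵈ.divides d ≡.refl) = begin
      (d ℕ.* q) × x  ≡⟨ ≡.cong (_× x) (ℕₚ.*-comm d q) ⟩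
      (q ℕ.* d) × x  ≈⟨ ×-assocˡ x q d ⟨
      q × (d × x)    ≈⟨ char-q (d × x) ⟩
      0#             ∎

    0^q≈0 : 0# ^ q ≈ 0#
    0^q≈0 = pos q {{prime⇒nonZero prime-q}}
      where
      pos : ∀ n → .{{NonZero n}} → 0# ^ n ≈ 0#
      pos (suc n) = zeroˡ _

    -- In the binomial theorem the inner coefficients are multiples of `q`, so only the two extreme
    -- terms survive.
    ^q-homo-+ : ∀ x y → (x + y) ^ q ≈ x ^ q + y ^ q
    ^q-homo-+ x y = go q ≡.refl
      where
      go : ∀ n → n ≡ q → (x + y) ^ n ≈ x ^ n + y ^ n
      go zero    0≡q = contradiction (prime⇒nonZero (≡.subst Prime (≡.sym 0≡q) prime-q)) λ()
      go (suc r) eq  = begin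
        (x + y) ^ suc r                                ≈⟨ theorem (suc r) x y ⟩
        t zero + sum (t ∘ suc)                         ≈⟨ +-congˡ (sum-init-last (t ∘ suc)) ⟩
        t zero + (sum (init (t ∘ suc)) + last (t ∘ suc))
          ≈⟨ +-cong first (+-cong (trans (sum-cong-≋ middle) (sum-replicate-zero r)) final) ⟩
        y ^ suc r + (0# + x ^ suc r)                   ≈⟨ +-congˡ (+-identityˡ _) ⟩
        y ^ suc r + x ^ suc r                          ≈⟨ +-comm _ _ ⟩
        x ^ suc r + y ^ suc r                          ∎
        where
        t : Vector Carrier (suc (suc r))
        t = binomialTerm x y (suc r)
        first : t zero ≈ y ^ suc r
        first = trans (×-homo-1 _) (*-identityˡ _)
        middle : ∀ i → init (t ∘ suc) i ≈ 0#
        middle i = q∣n⇒n×x≈0 _ (≡.subst (λ k → q ℕᵈ.∣ suc r C suc k) (≡.sym (toℕ-inject₁ i))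
          (≡.subst (λ k → k ℕᵈ.∣ suc r C suc (toℕ i)) eq
            (prime∣binomial (≡.subst Prime (≡.sym eq) prime-q) (toℕ i) (ℕ.s≤s (toℕ<n i)))))
        final : last (t ∘ suc) ≈ x ^ suc r
        final rewrite toℕ-fromℕ r | nCn≡1 (suc r) | ℕₚ.n∸n≡0 r =
          trans (×-homo-1 _) (*-identityʳ _)

    ^q-homo-sum : ∀ {n} (xs : Vector Carrier n) → sum xs ^ q ≈ sum (λ i → xs i ^ q)
    ^q-homo-sum {zero}  xs = 0^q≈0
    ^q-homo-sum {suc n} xs = trans (^q-homo-+ _ _) (+-congˡ (^q-homo-sum (xs ∘ suc)))

-- Group operations, indicators and finite sums.

module GroupPowers {v : ℕ} (G : FiniteAbelianGroup v) where
  open FiniteAbelianGroup G public using (isAbelianGroup)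

  abelianGroup : AbelianGroup 0ℓ 0ℓ
  abelianGroup = record { isAbelianGroup = isAbelianGroup }

  open AbelianGroup abelianGroup public
    using (_∙_; ε; _⁻¹; assoc; comm; identityˡ; identityʳ; inverseˡ; inverseʳ; monoid; commutativeMonoid)
  open import Algebra.Properties.AbelianGroup abelianGroup public
    using (⁻¹-involutive; \\-leftDividesˡ; \\-leftDividesʳ; ⁻¹-∙-comm; ε⁻¹≈ε; ∙-cancelˡ; inverseˡ-unique)
  open import Algebra.Properties.CommutativeMonoid.Mult commutativeMonoid public
    using (×-distrib-+)
  open import Algebra.Properties.Monoid.Mult monoid public
    using (×-homo-+; ×-assocˡ)
  open import Algebra.Properties.Monoid.Mult monoid using (_×_)

  infixr 8 _^_
  _^_ : Fin v → ℕ → Fin v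
  g ^ n = n × g

  translation : Fin v → Permutation v v
  translation g = permutation (g ∙_) (g ⁻¹ ∙_) (\\-leftDividesˡ g) (\\-leftDividesʳ g)

  reflected : ∀ x a → (a ⁻¹ ∙ x) ⁻¹ ∙ x ≡ a
  reflected x a = begin
    (a ⁻¹ ∙ x) ⁻¹ ∙ x       ≡⟨ ≡.cong (_∙ x) (⁻¹-∙-comm (a ⁻¹) x) ⟨
    (a ⁻¹ ⁻¹ ∙ x ⁻¹) ∙ x    ≡⟨ assoc _ _ _ ⟩
    a ⁻¹ ⁻¹ ∙ (x ⁻¹ ∙ x)    ≡⟨ ≡.cong₂ _∙_ (⁻¹-involutive a) (inverseˡ x) ⟩
    a ∙ ε                   ≡⟨ identityʳ a ⟩
    a                       ∎
    where open ≡.≡-Reasoning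

  -- The substitution that exchanges the two factors of a convolution at `x`; being an involution,
  -- it is its own inverse.
  reflection : Fin v → Permutation v v
  reflection x = permutation (λ a → a ⁻¹ ∙ x) (λ a → a ⁻¹ ∙ x) (reflected x) (reflected x)

module FiniteSums {c ℓ} (R : CommutativeSemiring c ℓ) where
  open CommutativeSemiring R hiding (zero)
  open import Algebra.Properties.Semiring.Sum semiring as Sum using (sum)

  -- The Iverson bracket. Sums over subsets, fibres and subgroups become weighted sums over the
  -- whole index type.
  ⟦_⟧ : ∀ {a} {P : Set a} → Dec P → Carrier
  ⟦ d ⟧ = if does d then 1# else 0#

  ⟦⟧-true : ∀ {a} {P : Set a} (d : Dec P) → P → ⟦ d ⟧ ≡ 1#
  ⟦⟧-true (yes _) _ = ≡.refl
  ⟦⟧-true (no ¬p) p = contradiction p ¬p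

  ⟦⟧-false : ∀ {a} {P : Set a} (d : Dec P) → ¬ P → ⟦ d ⟧ ≡ 0#
  ⟦⟧-false (yes p) ¬p = contradiction p ¬p
  ⟦⟧-false (no _)  _  = ≡.refl

  ⟦⟧-cong : ∀ {a b} {P : Set a} {Q : Set b} (d : Dec P) (d′ : Dec Q) → (P → Q) → (Q → P) → ⟦ d ⟧ ≡ ⟦ d′ ⟧
  ⟦⟧-cong (yes p) d′ f g = ≡.sym (⟦⟧-true d′ (f p))
  ⟦⟧-cong (no ¬p) d′ f g = ≡.sym (⟦⟧-false d′ (¬p ∘ g))

  sum-⟦⟧ : ∀ {n} (i : Fin n) (f : Fin n → Carrier) → sum (λ j → ⟦ i ≟ j ⟧ * f j) ≈ f i
  sum-⟦⟧ {suc n} zero    f = trans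
    (+-cong (*-identityˡ _) (trans (Sum.sum-cong-≋ (λ j → zeroˡ (f (suc j)))) (Sum.sum-replicate-zero n)))
    (+-identityʳ _)
  sum-⟦⟧ {suc n} (suc i) f = trans (+-cong (zeroˡ _) (sum-⟦⟧ i (f ∘ suc))) (+-identityˡ _)

  -- With the length fixed, sums are neutral terms, so that Agda can infer their summands.
  module Over (n : ℕ) where
    ∑ : (Fin n → Carrier) → Carrier
    ∑ = sum

    ∑-cong : ∀ {f h} → (∀ i → f i ≈ h i) → ∑ f ≈ ∑ h
    ∑-cong = Sum.sum-cong-≋

    ∑-cong-≡ : ∀ {f h} → (∀ i → f i ≡ h i) → ∑ f ≡ ∑ h
    ∑-cong-≡ = Sum.sum-cong-≗

    ∑-zero : ∑ (λ _ → 0#) ≈ 0#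
    ∑-zero = Sum.sum-replicate-zero n

    ∑-+ : ∀ f h → ∑ (λ i → f i + h i) ≈ ∑ f + ∑ h
    ∑-+ = Sum.∑-distrib-+

    ∑-*ˡ : ∀ r f → ∑ (λ i → r * f i) ≈ r * ∑ f
    ∑-*ˡ r f = sym (Sum.*-distribˡ-sum r f)

    ∑-*ʳ : ∀ f r → ∑ (λ i → f i * r) ≈ ∑ f * r
    ∑-*ʳ f r = sym (Sum.*-distribʳ-sum r f)

    ∑-comm : ∀ (f : Fin n → Fin n → Carrier) → ∑ (λ i → ∑ (λ j → f i j)) ≈ ∑ (λ j → ∑ (λ i → f i j))
    ∑-comm = Sum.∑-comm

    ∑-permute : ∀ f (π : Permutation n n) → ∑ f ≈ ∑ (λ i → f (π ⟨$⟩ʳ i))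
    ∑-permute = Sum.sum-permute

    ∑-⟦⟧ : ∀ i f → ∑ (λ j → ⟦ i ≟ j ⟧ * f j) ≈ f i
    ∑-⟦⟧ = sum-⟦⟧

-- The group ring, as functions under convolution.

module GroupRing {c ℓ} (R : CommutativeSemiring c ℓ) {v : ℕ} (G : FiniteAbelianGroup v) where
  open CommutativeSemiring R hiding (zero)
  open import Algebra.Properties.Semiring.Sum semiring using (sum)
  open import Algebra.Properties.Semiring.Mult semiring using (_×_)
  open import Algebra.Properties.Semiring.Exp semiring using (_^_)
  open import Algebra.Properties.CommutativeSemigroup *-commutativeSemigroup using (x∙yz≈y∙xz)
  open import Relation.Binary.Reasoning.Setoid setoid
  open FiniteSums R
  open FiniteSums.Over R v
  module 𝔾 = GroupPowers G
  open 𝔾 using (_∙_; _⁻¹; ε)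

  Element : Set c
  Element = Fin v → Carrier

  infixl 7 _⋆_
  _⋆_ : Element → Element → Element
  (f ⋆ h) x = ∑ (λ a → f a * h (a ⁻¹ ∙ x))

  δ : Fin v → Element
  δ g x = ⟦ g ≟ x ⟧

  infix 4 _≋_
  _≋_ : Element → Element → Set ℓ
  f ≋ h = ∀ x → f x ≈ h x

  ⋆-cong : ∀ {f f′ h h′} → f ≋ f′ → h ≋ h′ → f ⋆ h ≋ f′ ⋆ h′
  ⋆-cong f≋f′ h≋h′ x = ∑-cong λ a → *-cong (f≋f′ a) (h≋h′ _)

  ⋆-comm : ∀ f h → f ⋆ h ≋ h ⋆ f
  ⋆-comm f h x = begin
    ∑ (λ a → f a * h (a ⁻¹ ∙ x))                              ≈⟨ ∑-permute _ (𝔾.reflection x) ⟩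
    ∑ (λ a → f (a ⁻¹ ∙ x) * h ((a ⁻¹ ∙ x) ⁻¹ ∙ x))
      ≡⟨ ∑-cong-≡ (λ a → ≡.cong (λ b → f (a ⁻¹ ∙ x) * h b) (𝔾.reflected x a)) ⟩
    ∑ (λ a → f (a ⁻¹ ∙ x) * h a)                              ≈⟨ ∑-cong (λ a → *-comm _ _) ⟩
    ∑ (λ a → h a * f (a ⁻¹ ∙ x))                              ∎

  ⋆-assoc : ∀ f h k → (f ⋆ h) ⋆ k ≋ f ⋆ (h ⋆ k)
  ⋆-assoc f h k x = begin
    ∑ (λ b → ∑ (λ a → f a * h (a ⁻¹ ∙ b)) * k (b ⁻¹ ∙ x))
      ≈⟨ ∑-cong (λ b → trans (sym (∑-*ʳ (λ a → f a * h (a ⁻¹ ∙ b)) _)) (∑-cong λ a → *-assoc _ _ _)) ⟩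
    ∑ (λ b → ∑ (λ a → f a * (h (a ⁻¹ ∙ b) * k (b ⁻¹ ∙ x))))
      ≈⟨ ∑-comm (λ b a → f a * (h (a ⁻¹ ∙ b) * k (b ⁻¹ ∙ x))) ⟩
    ∑ (λ a → ∑ (λ b → f a * (h (a ⁻¹ ∙ b) * k (b ⁻¹ ∙ x))))
      ≈⟨ ∑-cong (λ a → ∑-*ˡ (f a) (λ b → h (a ⁻¹ ∙ b) * k (b ⁻¹ ∙ x))) ⟩
    ∑ (λ a → f a * ∑ (λ b → h (a ⁻¹ ∙ b) * k (b ⁻¹ ∙ x)))
      ≈⟨ ∑-cong (λ a → *-congˡ (∑-permute _ (𝔾.translation a))) ⟩
    ∑ (λ a → f a * ∑ (λ b → h (a ⁻¹ ∙ (a ∙ b)) * k ((a ∙ b) ⁻¹ ∙ x)))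
      ≡⟨ ∑-cong-≡ (λ a → ≡.cong (f a *_) (∑-cong-≡ λ b →
           ≡.cong₂ (λ y z → h y * k z) (𝔾.\\-leftDividesʳ a b) (shift a b))) ⟩
    ∑ (λ a → f a * ∑ (λ b → h b * k (b ⁻¹ ∙ (a ⁻¹ ∙ x))))  ∎
    where
    shift : ∀ a b → (a ∙ b) ⁻¹ ∙ x ≡ b ⁻¹ ∙ (a ⁻¹ ∙ x)
    shift a b = ≡.trans (≡.cong (_∙ x) (≡.trans (≡.sym (𝔾.⁻¹-∙-comm a b)) (𝔾.comm _ _))) (𝔾.assoc _ _ _)

  ⋆-identityˡ : ∀ f → δ ε ⋆ f ≋ f
  ⋆-identityˡ f x = trans (∑-⟦⟧ ε (λ a → f (a ⁻¹ ∙ x)))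
    (reflexive (≡.cong f (≡.trans (≡.cong (_∙ x) 𝔾.ε⁻¹≈ε) (𝔾.identityˡ x))))

  groupRing : CommutativeSemiring c ℓ
  groupRing = record
    { Carrier = Element
    ; _≈_ = _≋_
    ; _+_ = λ f h x → f x + h x
    ; _*_ = _⋆_
    ; 0# = λ _ → 0#
    ; 1# = δ ε
    ; isCommutativeSemiring = isCommutativeSemiringˡ record
      { +-isCommutativeMonoid = Pointwise.isCommutativeMonoid (Fin v) +-isCommutativeMonoid
      ; *-isCommutativeMonoid = record
        { isMonoid = record
          { isSemigroup = record
            { isMagma = record
              { isEquivalence = Pointwise.isEquivalence (Fin v) isEquivalence
              ; ∙-cong = ⋆-cong
              }
            ; assoc = ⋆-assoc
            }
          ; identity = ⋆-identityˡ , λ f x → trans (⋆-comm f (δ ε) x) (⋆-identityˡ f x)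
          }
        ; comm = ⋆-comm
        }
      ; distribʳ = λ f h k x → trans (∑-cong (λ a → distribʳ _ _ _))
          (∑-+ (λ a → h a * f (a ⁻¹ ∙ x)) (λ a → k a * f (a ⁻¹ ∙ x)))
      ; zeroˡ = λ f x → trans (∑-cong (λ a → zeroˡ _)) (∑-zero)
      }
    }
    where open import Data.Product using (_,_)

  private module RG = CommutativeSemiring groupRing
  open import Algebra.Properties.Semiring.Exp RG.semiring as Exp⋆ public
    using () renaming (_^_ to _^⋆_)
  open import Algebra.Properties.Semiring.Sum RG.semiring as Sum⋆ using ()
  open import Algebra.Properties.Semiring.Mult RG.semiring as Mult⋆ using ()

  monomial : Carrier → Fin v → Element
  monomial r g x = ⟦ g ≟ x ⟧ * r

  sum-pointwise : ∀ {n} (F : Fin n → Element) x → Sum⋆.sum F x ≡ sum (λ i → F i x)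
  sum-pointwise {zero}  F x = ≡.refl
  sum-pointwise {suc n} F x = ≡.cong (F zero x +_) (sum-pointwise (F ∘ suc) x)

  ×-pointwise : ∀ n f x → (n Mult⋆.× f) x ≡ n × f x
  ×-pointwise zero    f x = ≡.refl
  ×-pointwise (suc n) f x = ≡.cong (f x +_) (×-pointwise n f x)

  monomial-⋆ : ∀ r s g h → monomial r g ⋆ monomial s h ≋ monomial (r * s) (g ∙ h)
  monomial-⋆ r s g h x = begin
    ∑ (λ a → (⟦ g ≟ a ⟧ * r) * (⟦ h ≟ a ⁻¹ ∙ x ⟧ * s))   ≈⟨ ∑-cong (λ a → *-assoc _ _ _) ⟩
    ∑ (λ a → ⟦ g ≟ a ⟧ * (r * (⟦ h ≟ a ⁻¹ ∙ x ⟧ * s)))   ≈⟨ ∑-⟦⟧ g _ ⟩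
    r * (⟦ h ≟ g ⁻¹ ∙ x ⟧ * s)                              ≈⟨ x∙yz≈y∙xz _ _ _ ⟩
    ⟦ h ≟ g ⁻¹ ∙ x ⟧ * (r * s)
      ≡⟨ ≡.cong (_* (r * s)) (⟦⟧-cong (h ≟ g ⁻¹ ∙ x) (g ∙ h ≟ x)
           (λ eq → ≡.trans (≡.cong (g ∙_) eq) (𝔾.\\-leftDividesˡ g x))
           (λ eq → ≡.trans (≡.sym (𝔾.\\-leftDividesʳ g h)) (≡.cong (g ⁻¹ ∙_) eq))) ⟩
    ⟦ g ∙ h ≟ x ⟧ * (r * s)                                 ∎

  monomial-^ : ∀ r g n → monomial r g ^⋆ n ≋ monomial (r ^ n) (g 𝔾.^ n)
  monomial-^ r g zero    x = sym (*-identityʳ _)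
  monomial-^ r g (suc n) x = trans (⋆-cong {monomial r g} (λ _ → refl) (monomial-^ r g n) x) (monomial-⋆ r (r ^ n) g (g 𝔾.^ n) x)

  sum-monomials : ∀ f → f ≋ Sum⋆.sum (λ g → monomial (f g) g)
  sum-monomials f x = sym (begin
    Sum⋆.sum (λ g → monomial (f g) g) x  ≡⟨ sum-pointwise (λ g → monomial (f g) g) x ⟩
    ∑ (λ g → ⟦ g ≟ x ⟧ * f g)
      ≡⟨ ∑-cong-≡ (λ g → ≡.cong (_* f g) (⟦⟧-cong (g ≟ x) (x ≟ g) ≡.sym ≡.sym)) ⟩
    ∑ (λ g → ⟦ x ≟ g ⟧ * f g)          ≈⟨ ∑-⟦⟧ x f ⟩
    f x                                  ∎)

  module _ {q : ℕ} (prime-q : Prime q) (char-q : ∀ r → q × r ≈ 0#) where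
    open FreshmansDream groupRing using (^q-homo-sum)

    -- The Frobenius map can be applied to each monomial of `f` separately. The result is a sum over
    -- the fibre of `g ↦ g ^ q`, which need not be injective: primes dividing the group order are
    -- covered too.
    frobenius : ∀ f → (∀ g → f g ^ q ≈ f g) → ∀ x → (f ^⋆ q) x ≈ ∑ (λ g → ⟦ g 𝔾.^ q ≟ x ⟧ * f g)
    frobenius f fermat x = begin
      (f ^⋆ q) x                                      ≈⟨ Exp⋆.^-congˡ q (sum-monomials f) x ⟩
      (Sum⋆.sum (λ g → monomial (f g) g) ^⋆ q) x      ≈⟨ ^q-homo-sum prime-q char⋆ (λ g → monomial (f g) g) x ⟩
      Sum⋆.sum (λ g → monomial (f g) g ^⋆ q) x        ≡⟨ sum-pointwise (λ g → monomial (f g) g ^⋆ q) x ⟩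
      ∑ (λ g → (monomial (f g) g ^⋆ q) x)           ≈⟨ ∑-cong (λ g → monomial-^ (f g) g q x) ⟩
      ∑ (λ g → ⟦ g 𝔾.^ q ≟ x ⟧ * f g ^ q)           ≈⟨ ∑-cong (λ g → *-congˡ (fermat g)) ⟩
      ∑ (λ g → ⟦ g 𝔾.^ q ≟ x ⟧ * f g)               ∎
      where
      char⋆ : ∀ h → q Mult⋆.× h ≋ (λ _ → 0#)
      char⋆ h y = trans (reflexive (×-pointwise q h y)) (char-q (h y))

open import Data.Integer as ℤ using (ℤ; +_; -_; -[1+_]; _+_; _*_; _-_; 0ℤ; 1ℤ; -1ℤ)
open import Data.Integer.Divisibility.Signed using (_∣_; divides; ∣ᵤ⇒∣; ∣⇒∣ᵤ; ∣m∣n⇒∣m+n; ∣m⇒∣m*n; ∣n⇒∣m*n; ∣m⇒∣-m)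
import Data.Integer.Properties as ℤₚ
open import Data.Integer.Tactic.RingSolver using (solve-∀)

-- Congruences of integers and Fermat's little theorem.

infix 4 _≡_[mod_]
-- A record rather than a synonym for divisibility, so that unification can read off `a` and `b`,
-- which the difference `a - b` would hide once computed.
record _≡_[mod_] (a b : ℤ) (n : ℕ) : Set where
  constructor congruent
  field n∣a-b : + n ∣ a - b
open _≡_[mod_] public

module ModN (n : ℕ) where
  ≡⇒≡[mod] : ∀ {a b} → a ≡ b → a ≡ b [mod n ]
  ≡⇒≡[mod] {a} ≡.refl = congruent (divides 0ℤ (ℤₚ.+-inverseʳ a))

  private
    cast : ∀ {a b} → a ≡ b → + n ∣ a → + n ∣ b
    cast = ≡.subst (+ n ∣_)

  mod-sym : ∀ {a b} → a ≡ b [mod n ] → b ≡ a [mod n ]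
  mod-sym {a} {b} (congruent d) = congruent (cast (eq a b) (∣m⇒∣-m d))
    where eq : ∀ a b → - (a - b) ≡ b - a
          eq = solve-∀

  mod-trans : ∀ {a b c} → a ≡ b [mod n ] → b ≡ c [mod n ] → a ≡ c [mod n ]
  mod-trans {a} {b} {c} (congruent d) (congruent d′) = congruent (cast (eq a b c) (∣m∣n⇒∣m+n d d′))
    where eq : ∀ a b c → (a - b) + (b - c) ≡ a - c
          eq = solve-∀

  mod-+ : ∀ {a b c d} → a ≡ b [mod n ] → c ≡ d [mod n ] → a + c ≡ b + d [mod n ]
  mod-+ {a} {b} {c} {d} (congruent x) (congruent y) = congruent (cast (eq a b c d) (∣m∣n⇒∣m+n x y))
    where eq : ∀ a b c d → (a - b) + (c - d) ≡ (a + c) - (b + d)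
          eq = solve-∀

  mod-* : ∀ {a b c d} → a ≡ b [mod n ] → c ≡ d [mod n ] → a * c ≡ b * d [mod n ]
  mod-* {a} {b} {c} {d} (congruent x) (congruent y) =
    congruent (cast (eq a b c d) (∣m∣n⇒∣m+n (∣m⇒∣m*n c x) (∣n⇒∣m*n b y)))
    where eq : ∀ a b c d → (a - b) * c + b * (c - d) ≡ a * c - b * d
          eq = solve-∀

  ∣⇒≡0 : ∀ {a} → + n ∣ a → a ≡ 0ℤ [mod n ]
  ∣⇒≡0 {a} d = congruent (cast (≡.sym (ℤₚ.+-identityʳ a)) d)

  ≡0⇒∣ : ∀ {a} → a ≡ 0ℤ [mod n ] → + n ∣ a
  ≡0⇒∣ {a} (congruent d) = cast (ℤₚ.+-identityʳ a) d

  ℤ/n : CommutativeSemiring 0ℓ 0ℓ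
  ℤ/n = record
    { Carrier = ℤ
    ; _≈_ = _≡_[mod n ]
    ; _+_ = _+_
    ; _*_ = _*_
    ; 0# = 0ℤ
    ; 1# = 1ℤ
    ; isCommutativeSemiring = isCommutativeSemiringˡ record
      { +-isCommutativeMonoid = record
        { isMonoid = record
          { isSemigroup = record
            { isMagma = record { isEquivalence = equiv ; ∙-cong = mod-+ }
            ; assoc = λ a b c → ≡⇒≡[mod] (ℤₚ.+-assoc a b c)
            }
          ; identity = (λ a → ≡⇒≡[mod] (ℤₚ.+-identityˡ a)) , λ a → ≡⇒≡[mod] (ℤₚ.+-identityʳ a)
          }
        ; comm = λ a b → ≡⇒≡[mod] (ℤₚ.+-comm a b)
        }
      ; *-isCommutativeMonoid = record
        { isMonoid = record
          { isSemigroup = record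
            { isMagma = record { isEquivalence = equiv ; ∙-cong = mod-* }
            ; assoc = λ a b c → ≡⇒≡[mod] (ℤₚ.*-assoc a b c)
            }
          ; identity = (λ a → ≡⇒≡[mod] (ℤₚ.*-identityˡ a)) , λ a → ≡⇒≡[mod] (ℤₚ.*-identityʳ a)
          }
        ; comm = λ a b → ≡⇒≡[mod] (ℤₚ.*-comm a b)
        }
      ; distribʳ = λ a b c → ≡⇒≡[mod] (ℤₚ.*-distribʳ-+ a b c)
      ; zeroˡ = λ a → ≡⇒≡[mod] (ℤₚ.*-zeroˡ a)
      }
    }
    where
    equiv : IsEquivalence (_≡_[mod n ])
    equiv = record { refl = ≡⇒≡[mod] ≡.refl ; sym = mod-sym ; trans = mod-trans }

  open CommutativeSemiring ℤ/n using (semiring)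
  open import Algebra.Properties.Semiring.Mult semiring using (_×_)

  ×≡* : ∀ m a → m × a ≡ + m * a
  ×≡* zero    a = ≡.sym (ℤₚ.*-zeroˡ a)
  ×≡* (suc m) a = ≡.trans (≡.cong (_+_ a) (×≡* m a)) (≡.sym (ℤₚ.suc-* (+ m) a))

  characteristic : ∀ a → n × a ≡ 0ℤ [mod n ]
  characteristic a = ∣⇒≡0 (≡.subst (+ n ∣_) (≡.sym (×≡* n a)) (∣m⇒∣m*n a (divides 1ℤ (≡.sym (ℤₚ.*-identityˡ (+ n))))))

euclid : ∀ {q} → Prime q → ∀ a b → + q ∣ a * b → + q ∣ a ⊎ + q ∣ b
euclid prime-q a b q∣ab = [ inj₁ ∘ ∣ᵤ⇒∣ , inj₂ ∘ ∣ᵤ⇒∣ ]′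
  (euclidsLemma ℤ.∣ a ∣ ℤ.∣ b ∣ prime-q (≡.subst (_ ℕᵈ.∣_) (ℤₚ.abs-* a b) (∣⇒∣ᵤ q∣ab)))

module _ {q : ℕ} (prime-q : Prime q) where
  open ModN q
  open CommutativeSemiring ℤ/n using (semiring)
  open import Algebra.Properties.Semiring.Exp semiring using (_^_)
  open import Algebra.Properties.Semiring.Sum semiring using (sum)

  ^≡ℤ^ : ∀ a n → a ^ n ≡ a ℤ.^ n
  ^≡ℤ^ a zero    = ≡.refl
  ^≡ℤ^ a (suc n) = ≡.cong (a *_) (^≡ℤ^ a n)

  -- This is the Frobenius map applied to `n` written as a sum of ones.
  fermat : ∀ n → (+ n) ℤ.^ q ≡ + n [mod q ]
  fermat n = ≡.subst₂ (_≡_[mod q ])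
    (≡.trans (^≡ℤ^ (sum {n} (λ _ → 1ℤ)) q) (≡.cong (ℤ._^ q) (∑1 n ≡.refl)))
    (∑1 n (≡.trans (^≡ℤ^ 1ℤ q) (ℤₚ.^-zeroˡ q)))
    (FreshmansDream.^q-homo-sum ℤ/n prime-q characteristic {n} (λ _ → 1ℤ))
    where
    ∑1 : ∀ {a} m → a ≡ 1ℤ → sum {m} (λ _ → a) ≡ + m
    ∑1 zero    a≡1 = ≡.refl
    ∑1 (suc m) a≡1 = ≡.cong₂ _+_ a≡1 (∑1 m a≡1)

  module _ {v : ℕ} (G : FiniteAbelianGroup v) where
    open GroupRing ℤ/n G using (_^⋆_; frobenius; module 𝔾)
    open FiniteSums ℤ/n using (⟦_⟧; module Over)
    open Over v using (∑)

    frobenius-ℤ : ∀ f → (∀ g → f g ℤ.^ q ≡ f g [mod q ]) →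
      ∀ x → (f ^⋆ q) x ≡ ∑ (λ g → ⟦ g 𝔾.^ q ≟ x ⟧ * f g) [mod q ]
    frobenius-ℤ f f^q≡f = frobenius prime-q characteristic f
      (λ g → ≡.subst (_≡ f g [mod q ]) (≡.sym (^≡ℤ^ (f g) q)) (f^q≡f g))

open import Data.Product using (_×_)

-- Coefficients -1, 0 and 1.

data Trit : ℤ → Set where
  neg  : Trit -1ℤ
  none : Trit 0ℤ
  pos  : Trit 1ℤ

trit-^odd : ∀ {a} → Trit a → ∀ m → a ℤ.^ suc (m ℕ.* 2) ≡ a
trit-^odd neg  zero    = ≡.refl
trit-^odd neg  (suc m) = ≡.trans (≡.sym (ℤₚ.*-assoc -1ℤ -1ℤ (-1ℤ ℤ.^ suc (m ℕ.* 2)))) (≡.trans (ℤₚ.*-identityˡ _) (trit-^odd neg m))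
trit-^odd none m       = ℤₚ.*-zeroˡ (0ℤ ℤ.^ (m ℕ.* 2))
trit-^odd pos  m       = ℤₚ.^-zeroˡ (suc (m ℕ.* 2))

-- The two values differ by at most 2, too little for a nonzero multiple of `q`. Congruences between
-- coefficients thereby become equalities.
trit-≡ : ∀ {a b q} → Trit a → Trit b → 3 ℕ.≤ q → a ≡ b [mod q ] → a ≡ b
trit-≡ {a} {b} {q} ta tb 3≤q (congruent q∣) = go ta tb (∣⇒∣ᵤ q∣)
  where
  small : ∀ k → .{{NonZero k}} → k ℕ.≤ 2 → ¬ (q ℕᵈ.∣ k)
  small k k≤2 q∣k = ℕₚ.<⇒≱ (ℕ.s≤s k≤2) (ℕₚ.≤-trans 3≤q (ℕᵈ.∣⇒≤ q∣k))
  1≤2 : 1 ℕ.≤ 2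
  1≤2 = ℕ.s≤s ℕ.z≤n
  go : ∀ {a b} → Trit a → Trit b → q ℕᵈ.∣ ℤ.∣ a - b ∣ → a ≡ b
  go neg  neg  _ = ≡.refl
  go neg  none d = contradiction d (small 1 1≤2)
  go neg  pos  d = contradiction d (small 2 ℕₚ.≤-refl)
  go none neg  d = contradiction d (small 1 1≤2)
  go none none _ = ≡.refl
  go none pos  d = contradiction d (small 1 1≤2)
  go pos  neg  d = contradiction d (small 2 ℕₚ.≤-refl)
  go pos  none d = contradiction d (small 1 1≤2)
  go pos  pos  _ = ≡.refl

open FiniteSums ℤₚ.+-*-commutativeSemiring

-- Elements whose square is a scalar plus a multiple of G.

module _ {v : ℕ} (G : FiniteAbelianGroup v) where
  open GroupPowers G
  open Over v using (∑)

  -- The identity E² = κ + cG in ℤ[G], coefficient by coefficient.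
  SquaresTo : (Fin v → ℤ) → ℤ → ℤ → Set
  SquaresTo E κ c = ∀ x → ∑ (λ a → E a * E (a ⁻¹ ∙ x)) ≡ κ * ⟦ ε ≟ x ⟧ + c

  module ScalarSquare (E : Fin v → ℤ) (κ c : ℤ) (square : SquaresTo E κ c) where

    module _ {q : ℕ} (prime-q : Prime q) where
      open ModN q
      open CommutativeSemiring ℤ/n using (setoid; refl; trans; sym; reflexive; *-congˡ; +-cong; +-congˡ; +-congʳ)
      open GroupRing ℤ/n G using (_⋆_; _^⋆_; ⋆-cong; ⋆-assoc; ⋆-comm; ⋆-identityˡ; δ)
      open FiniteSums.Over ℤ/n v using (∑-cong; ∑-cong-≡; ∑-+; ∑-*ˡ; ∑-permute; ∑-⟦⟧; ∑-zero)
      open import Relation.Binary.Reasoning.Setoid setoid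

      -- By associativity `E ⋆ E` acts on `f` as a unit: its scalar part multiplies by `κ`, and the
      -- sum of all group elements turns `f` into the constant function `∑ f`.
      E⋆E⋆ : ∀ f x → (E ⋆ (E ⋆ f)) x ≡ κ * f x + c * ∑ f [mod q ]
      E⋆E⋆ f x = begin
        (E ⋆ (E ⋆ f)) x                                        ≈⟨ sym (⋆-assoc E E f x) ⟩
        ∑ (λ a → (E ⋆ E) a * f (a ⁻¹ ∙ x))                      ≡⟨ ∑-cong-≡ (λ a → ≡.cong (_* f (a ⁻¹ ∙ x)) (square a)) ⟩
        ∑ (λ a → (κ * ⟦ ε ≟ a ⟧ + c) * f (a ⁻¹ ∙ x))            ≡⟨ ∑-cong-≡ (λ a → expand κ ⟦ ε ≟ a ⟧ c _) ⟩
        ∑ (λ a → κ * (⟦ ε ≟ a ⟧ * f (a ⁻¹ ∙ x)) + c * f (a ⁻¹ ∙ x))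
          ≈⟨ ∑-+ (λ a → κ * (⟦ ε ≟ a ⟧ * f (a ⁻¹ ∙ x))) (λ a → c * f (a ⁻¹ ∙ x)) ⟩
        ∑ (λ a → κ * (⟦ ε ≟ a ⟧ * f (a ⁻¹ ∙ x))) + ∑ (λ a → c * f (a ⁻¹ ∙ x))
          ≈⟨ +-cong (∑-*ˡ κ (λ a → ⟦ ε ≟ a ⟧ * f (a ⁻¹ ∙ x))) (∑-*ˡ c (λ a → f (a ⁻¹ ∙ x))) ⟩
        κ * (δ ε ⋆ f) x + c * ∑ (λ a → f (a ⁻¹ ∙ x))
          ≈⟨ +-cong (*-congˡ {κ} (⋆-identityˡ f x)) (*-congˡ {c} (sym (∑-permute f (reflection x)))) ⟩
        κ * f x + c * ∑ f                                       ∎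
        where
        expand : ∀ a b c d → (a * b + c) * d ≡ a * (b * d) + c * d
        expand = solve-∀

      E^1 : ∀ x → (E ^⋆ 1) x ≡ E x [mod q ]
      E^1 x = trans (⋆-comm E (δ ε) x) (⋆-identityˡ E x)

      -- Two more factors `E` multiply by `κ` and add a constant function. The constant `d` is left
      -- unspecified, since its residue can be found afterwards from a single coefficient.
      odd-power : ∀ m → ∃ λ d → ∀ x → (E ^⋆ suc (m ℕ.* 2)) x ≡ κ ℤ.^ m * E x + d [mod q ]
      odd-power zero    = 0ℤ , λ x → trans (E^1 x) (reflexive (lemma (E x)))
        where lemma : ∀ a → a ≡ 1ℤ * a + 0ℤ
              lemma = solve-∀
      odd-power (suc m) with odd-power m
      ... | d , E^≈ = κ * d + c * ∑ (E ^⋆ suc (m ℕ.* 2)) , λ x → begin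
        (E ⋆ (E ⋆ (E ^⋆ suc (m ℕ.* 2)))) x                        ≈⟨ E⋆E⋆ (E ^⋆ suc (m ℕ.* 2)) x ⟩
        κ * (E ^⋆ suc (m ℕ.* 2)) x + c * ∑ (E ^⋆ suc (m ℕ.* 2))   ≈⟨ +-congʳ (*-congˡ {κ} (E^≈ x)) ⟩
        κ * (κ ℤ.^ m * E x + d) + c * ∑ (E ^⋆ suc (m ℕ.* 2))      ≡⟨ regroup κ (κ ℤ.^ m) (E x) d _ ⟩
        κ ℤ.^ suc m * E x + (κ * d + c * ∑ (E ^⋆ suc (m ℕ.* 2)))  ∎
        where
        regroup : ∀ k l e d s → k * (l * e + d) + s ≡ (k * l) * e + (k * d + s)
        regroup = solve-∀

      -- By injectivity the fibre of the `q`-th power over `g ^ q` is the single point `g`, so the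
      -- coefficient of `E ^⋆ q` there is `E g`. The same coefficient is known from `odd-power`,
      -- because `q` is odd.
      multiplier-mod : (∀ g → E g ℤ.^ q ≡ E g [mod q ]) → (∀ {g h} → g ^ q ≡ h ^ q → g ≡ h) → ε ^ q ≡ ε →
        ∀ m → q ≡ suc (m ℕ.* 2) → κ ℤ.^ m ≡ 1ℤ [mod q ] → ∀ g → E g ≡ E (g ^ q) [mod q ]
      multiplier-mod E^q ^q-inj ε^q m q≡ κ^m≡1 with odd-power m
      ... | d , E^≈ = λ g → trans (E≈ g) (trans (+-congˡ {E (g ^ q)} d≈0) (reflexive (ℤₚ.+-identityʳ _)))
        where
        E≈ : ∀ g → E g ≡ E (g ^ q) + d [mod q ]
        E≈ g = begin
          E g                                            ≈⟨ sym (∑-⟦⟧ g E) ⟩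
          ∑ (λ h → ⟦ g ≟ h ⟧ * E h)
            ≡⟨ ∑-cong-≡ (λ h → ≡.cong (_* E h) (⟦⟧-cong (g ≟ h) (h ^ q ≟ g ^ q)
                 (λ g≡h → ≡.cong (_^ q) (≡.sym g≡h)) (≡.sym ∘ ^q-inj))) ⟩
          ∑ (λ h → ⟦ h ^ q ≟ g ^ q ⟧ * E h)              ≈⟨ sym (frobenius-ℤ prime-q G E E^q (g ^ q)) ⟩
          (E ^⋆ q) (g ^ q)                               ≡⟨ ≡.cong (λ n → (E ^⋆ n) (g ^ q)) q≡ ⟩
          (E ^⋆ suc (m ℕ.* 2)) (g ^ q)                   ≈⟨ E^≈ (g ^ q) ⟩
          κ ℤ.^ m * E (g ^ q) + d                        ≈⟨ +-congʳ (mod-* κ^m≡1 (refl {E (g ^ q)})) ⟩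
          1ℤ * E (g ^ q) + d                             ≡⟨ ≡.cong (_+ d) (ℤₚ.*-identityˡ (E (g ^ q))) ⟩
          E (g ^ q) + d                                  ∎
        d≈0 : d ≡ 0ℤ [mod q ]
        d≈0 = begin
          d                       ≡⟨ cancel (E ε) d ⟩
          (E ε + d) - E ε         ≡⟨ ≡.cong (λ g → (E g + d) - E ε) ε^q ⟨
          (E (ε ^ q) + d) - E ε   ≈⟨ +-congʳ (sym (E≈ ε)) ⟩
          E ε - E ε               ≡⟨ ℤₚ.+-inverseʳ (E ε) ⟩
          0ℤ                      ∎
          where
          cancel : ∀ a b → b ≡ (a + b) - a
          cancel = solve-∀

      -- The square of `E` may keep a constant term modulo `q`; a third factor turns it into
      -- `c * ∑ E`, which vanishes. With `3 ≤ q` the `q`-th power then vanishes as well, and by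
      -- Frobenius its coefficients are the sums in question.
      fibre-sums : (∀ g → E g ℤ.^ q ≡ E g [mod q ]) → + q ∣ κ → + q ∣ ∑ E → 3 ℕ.≤ q →
        ∀ x → + q ∣ ∑ (λ g → ⟦ g ^ q ≟ x ⟧ * E g)
      fibre-sums E^q q∣κ q∣∑E (ℕ.s≤s (ℕ.s≤s (ℕ.s≤s {n = n} _))) x =
        ≡0⇒∣ (trans (sym (frobenius-ℤ prime-q G E E^q x)) (trans (reflexive (≡.cong (λ k → (E ^⋆ k) x) (ℕₚ.+-comm 3 n))) (high n x)))
        where
        cube : ∀ x → (E ^⋆ 3) x ≡ 0ℤ [mod q ]
        cube x = begin
          (E ^⋆ 3) x                            ≈⟨ E⋆E⋆ (E ^⋆ 1) x ⟩
          κ * (E ^⋆ 1) x + c * ∑ (E ^⋆ 1)       ≈⟨ +-cong (mod-* (∣⇒≡0 q∣κ) (refl {(E ^⋆ 1) x})) (*-congˡ {c} (trans (∑-cong E^1) (∣⇒≡0 q∣∑E))) ⟩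
          0ℤ * (E ^⋆ 1) x + c * 0ℤ              ≡⟨ zeros ((E ^⋆ 1) x) c ⟩
          0ℤ                                    ∎
          where
          zeros : ∀ a b → 0ℤ * a + b * 0ℤ ≡ 0ℤ
          zeros = solve-∀
        high : ∀ n x → (E ^⋆ (n ℕ.+ 3)) x ≡ 0ℤ [mod q ]
        high zero    x = cube x
        high (suc n) x = trans (⋆-cong {E} (λ _ → refl) (high n) x)
          (trans (∑-cong (λ a → reflexive (ℤₚ.*-zeroʳ (E a)))) ∑-zero)

⟦⟧-* : ∀ {a} {P : Set a} (d : Dec P) {x y : ℤ} → (P → x ≡ y) → ⟦ d ⟧ * x ≡ ⟦ d ⟧ * y
⟦⟧-* (yes p) x≡y = ≡.cong (1ℤ *_) (x≡y p)
⟦⟧-* (no _) {x} {y} _ = ≡.trans (ℤₚ.*-zeroˡ x) (≡.sym (ℤₚ.*-zeroˡ y))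

⟦⟧-^ : ∀ {a} {P : Set a} (d : Dec P) n → .{{NonZero n}} → ⟦ d ⟧ ℤ.^ n ≡ ⟦ d ⟧
⟦⟧-^ (yes _) n       = ℤₚ.^-zeroˡ n
⟦⟧-^ (no _)  (suc n) = ℤₚ.*-zeroˡ (0ℤ ℤ.^ n)

-- Lagrange's theorem, coprime exponents and torsion.

module Powers {v : ℕ} (G : FiniteAbelianGroup v) where
  open GroupPowers G

  ε^ : ∀ n → ε ^ n ≡ ε
  ε^ zero    = ≡.refl
  ε^ (suc n) = ≡.trans (identityˡ _) (ε^ n)

  ^-∙ : ∀ g h n → (g ∙ h) ^ n ≡ g ^ n ∙ h ^ n
  ^-∙ = ×-distrib-+

  ^-+ : ∀ g m n → g ^ (m ℕ.+ n) ≡ g ^ m ∙ g ^ n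
  ^-+ = ×-homo-+

  ^-* : ∀ g m n → g ^ (m ℕ.* n) ≡ (g ^ m) ^ n
  ^-* g m n = ≡.trans (≡.cong (g ^_) (ℕₚ.*-comm m n)) (≡.sym (×-assocˡ g n m))

  ^-swap : ∀ g m n → (g ^ m) ^ n ≡ (g ^ n) ^ m
  ^-swap g m n = ≡.trans (≡.sym (^-* g m n)) (≡.trans (≡.cong (g ^_) (ℕₚ.*-comm m n)) (^-* g n m))

  ⁻¹-^ : ∀ g n → (g ⁻¹) ^ n ≡ (g ^ n) ⁻¹
  ⁻¹-^ g n = inverseˡ-unique _ _ (begin
    (g ⁻¹) ^ n ∙ g ^ n  ≡⟨ ^-∙ (g ⁻¹) g n ⟨
    (g ⁻¹ ∙ g) ^ n      ≡⟨ ≡.cong (_^ n) (inverseˡ g) ⟩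
    ε ^ n               ≡⟨ ε^ n ⟩
    ε                   ∎)
    where open ≡.≡-Reasoning

  ^-∣ : ∀ {g m n} → m ℕᵈ.∣ n → g ^ m ≡ ε → g ^ n ≡ ε
  ^-∣ {g} {m} (ℕᵈ.divides d ≡.refl) g^m = begin
    g ^ (d ℕ.* m)  ≡⟨ ≡.cong (g ^_) (ℕₚ.*-comm d m) ⟩
    g ^ (m ℕ.* d)  ≡⟨ ^-* g m d ⟩
    (g ^ m) ^ d    ≡⟨ ≡.cong (_^ d) g^m ⟩
    ε ^ d          ≡⟨ ε^ d ⟩
    ε              ∎
    where open ≡.≡-Reasoning

  -- Translation by `g` permutes the group, so the product of all elements absorbs a factor `g ^ v`.
  lagrange : ∀ g → g ^ v ≡ ε
  lagrange g = cancel (begin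
    g ^ v ∙ Π (λ x → x)              ≡⟨ ≡.cong (_∙ Π (λ x → x)) (sum-replicate v) ⟨
    Π (λ _ → g) ∙ Π (λ x → x)        ≡⟨ ∑-distrib-+ {v} (λ _ → g) (λ x → x) ⟨
    Π (λ x → g ∙ x)                  ≡⟨ sum-permute {v} (λ x → x) (translation g) ⟨
    Π (λ x → x)                      ∎)
    where
    open ≡.≡-Reasoning
    open import Algebra.Properties.CommutativeMonoid.Sum commutativeMonoid
      using (sum; sum-permute; ∑-distrib-+; sum-replicate)
    Π : (Fin v → Fin v) → Fin v
    Π = sum
    cancel : ∀ {x y} → x ∙ y ≡ y → x ≡ ε
    cancel {x} {y} xy≡y = ∙-cancelˡ y _ _ (≡.trans (comm y x) (≡.trans xy≡y (≡.sym (identityʳ y))))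

  open Bézout using (+-; -+)

  -- Bézout inverts `m` modulo `n`, so a further power of `g ^ m` recovers `g`. When the coefficient
  -- of `m` is negative, that power is the inverse of `g` instead.
  ^-coprime-injective : ∀ {m n g h} → Coprime m n → g ^ n ≡ ε → h ^ n ≡ ε → g ^ m ≡ h ^ m → g ≡ h
  ^-coprime-injective {m} {n} {g} {h} coprime g^n h^n g^m≡h^m with coprime-Bézout coprime
  ... | +- x y eq = ≡.trans (recover g g^n) (≡.trans (≡.cong (_^ x) g^m≡h^m) (≡.sym (recover h h^n)))
    where
    recover : ∀ g → g ^ n ≡ ε → g ≡ (g ^ m) ^ x
    recover g g^n = begin
      g                  ≡⟨ identityʳ g ⟨
      g ∙ ε              ≡⟨ ≡.cong (g ∙_) (^-∣ (ℕᵈ.n∣m*n y) g^n) ⟨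
      g ^ (1 ℕ.+ y ℕ.* n)  ≡⟨ ≡.cong (g ^_) (≡.trans eq (ℕₚ.*-comm x m)) ⟩
      g ^ (m ℕ.* x)      ≡⟨ ^-* g m x ⟩
      (g ^ m) ^ x        ∎
      where open ≡.≡-Reasoning
  ... | -+ x y eq = ∙-cancelˡ ((g ^ m) ^ x) g h (begin
    (g ^ m) ^ x ∙ g    ≡⟨ trivial g g^n ⟩
    ε                  ≡⟨ trivial h h^n ⟨
    (h ^ m) ^ x ∙ h    ≡⟨ ≡.cong (λ z → z ^ x ∙ h) g^m≡h^m ⟨
    (g ^ m) ^ x ∙ h    ∎)
    where
    open ≡.≡-Reasoning
    trivial : ∀ g → g ^ n ≡ ε → (g ^ m) ^ x ∙ g ≡ ε
    trivial g g^n = begin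
      (g ^ m) ^ x ∙ g      ≡⟨ comm _ _ ⟩
      g ∙ (g ^ m) ^ x      ≡⟨ ≡.cong (g ∙_) (^-* g m x) ⟨
      g ∙ g ^ (m ℕ.* x)    ≡⟨ ≡.cong (λ k → g ∙ g ^ k) (ℕₚ.*-comm m x) ⟩
      g ^ (1 ℕ.+ x ℕ.* m)  ≡⟨ ≡.cong (g ^_) eq ⟩
      g ^ (y ℕ.* n)        ≡⟨ ^-∣ (ℕᵈ.n∣m*n y) g^n ⟩
      ε                    ∎

  coprime-torsion : ∀ {m n g} → Coprime m n → g ^ m ≡ ε → g ^ n ≡ ε → g ≡ ε
  coprime-torsion {m} {n} coprime g^m g^n =
    ^-coprime-injective coprime g^n (ε^ n) (≡.trans g^m (≡.sym (ε^ m)))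

  open Over v

  torsion : ℕ → Fin v → ℤ
  torsion n g = ⟦ g ^ n ≟ ε ⟧

  ∣torsion∣ : ℕ → ℤ
  ∣torsion∣ n = ∑ (torsion n)

  torsion-∙ : ∀ {n a} x → a ^ n ≡ ε → torsion n (a ⁻¹ ∙ x) ≡ torsion n x
  torsion-∙ {n} {a} x a^n = ≡.cong (λ y → ⟦ y ≟ ε ⟧) (begin
    (a ⁻¹ ∙ x) ^ n        ≡⟨ ^-∙ (a ⁻¹) x n ⟩
    (a ⁻¹) ^ n ∙ x ^ n    ≡⟨ ≡.cong (_∙ x ^ n) (≡.trans (⁻¹-^ a n) (≡.trans (≡.cong _⁻¹ a^n) ε⁻¹≈ε)) ⟩
    ε ∙ x ^ n             ≡⟨ identityˡ _ ⟩
    x ^ n                 ∎)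
    where open ≡.≡-Reasoning

  -- Cauchy's theorem in contrapositive form: the q-th power in (ℤ/q)[G] of the
  -- indicator f of the n-torsion vanishes if q divides its size (f ⋆ f is that
  -- size times f), while Frobenius puts coefficient 1 at the identity.
  prime∤∣torsion∣ : ∀ {q n} → Prime q → Coprime q n → ¬ (+ q ∣ ∣torsion∣ n)
  prime∤∣torsion∣ {q} {n} prime-q coprime q∣T = ¬prime[1] (≡.subst Prime (ℕᵈ.∣1⇒≡1 (∣⇒∣ᵤ q∣1)) prime-q)
    where
    open ModN q
    open GroupRing ℤ/n G using (_⋆_; _^⋆_; ⋆-cong; ⋆-assoc)
    module ℤ/q = CommutativeSemiring ℤ/n
    f = torsion n
    f⋆f : ∀ x → (f ⋆ f) x ≡ 0ℤ [mod q ]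
    f⋆f x = begin
      (f ⋆ f) x              ≡⟨ ∑-cong (λ a → ⟦⟧-* (a ^ n ≟ ε) (torsion-∙ {n} {a} x)) ⟩
      ∑ (λ a → f a * f x)    ≡⟨ ∑-*ʳ f (f x) ⟩
      ∣torsion∣ n * f x      ≈⟨ mod-* (∣⇒≡0 q∣T) (ℤ/q.refl {f x}) ⟩
      0ℤ * f x               ≡⟨ ℤₚ.*-zeroˡ (f x) ⟩
      0ℤ                     ∎
      where open import Relation.Binary.Reasoning.Setoid ℤ/q.setoid
    f^ : ∀ k x → (f ^⋆ (2 ℕ.+ k)) x ≡ 0ℤ [mod q ]
    f^ k x = begin
      (f ⋆ (f ⋆ (f ^⋆ k))) x                          ≈⟨ ⋆-assoc f f (f ^⋆ k) x ⟨
      ((f ⋆ f) ⋆ (f ^⋆ k)) x                          ≈⟨ ⋆-cong {h = f ^⋆ k} f⋆f (λ _ → ℤ/q.refl) x ⟩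
      ((λ _ → 0ℤ) ⋆ (f ^⋆ k)) x                       ≡⟨ ∑-cong (λ a → ℤₚ.*-zeroˡ ((f ^⋆ k) (a ⁻¹ ∙ x))) ⟩
      ∑ (λ _ → 0ℤ)                                    ≡⟨ ∑-zero ⟩
      0ℤ                                              ∎
      where open import Relation.Binary.Reasoning.Setoid ℤ/q.setoid
    f^q : ∀ x → (f ^⋆ q) x ≡ 0ℤ [mod q ]
    f^q x = ≡.subst (λ k → (f ^⋆ k) x ≡ 0ℤ [mod q ])
      (ℕₚ.m+[n∸m]≡n (ℕ.nonTrivial⇒n>1 q {{prime⇒nonTrivial prime-q}})) (f^ (q ℕ.∸ 2) x)
    q∣1 : + q ∣ 1ℤ
    q∣1 = ≡0⇒∣ (begin
      1ℤ                                              ≡⟨ ⟦⟧-true (ε ^ n ≟ ε) (ε^ n) ⟨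
      f ε                                             ≡⟨ ∑-⟦⟧ ε f ⟨
      ∑ (λ g → ⟦ ε ≟ g ⟧ * f g)                       ≡⟨ ∑-cong same ⟩
      ∑ (λ g → ⟦ g ^ q ≟ ε ⟧ * f g)                   ≈⟨ frobenius-ℤ prime-q G f
         (λ g → ≡⇒≡[mod] (⟦⟧-^ (g ^ n ≟ ε) q {{prime⇒nonZero prime-q}})) ε ⟨
      (f ^⋆ q) ε                                      ≈⟨ f^q ε ⟩
      0ℤ                                              ∎)
      where
      open import Relation.Binary.Reasoning.Setoid ℤ/q.setoid
      same : ∀ g → ⟦ ε ≟ g ⟧ * f g ≡ ⟦ g ^ q ≟ ε ⟧ * f g
      same g with g ^ n ≟ ε
      ... | no _     = ≡.trans (ℤₚ.*-zeroʳ ⟦ ε ≟ g ⟧) (≡.sym (ℤₚ.*-zeroʳ ⟦ g ^ q ≟ ε ⟧))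
      ... | yes g^n  = ≡.cong (_* 1ℤ) (⟦⟧-cong (ε ≟ g) (g ^ q ≟ ε)
                         (λ ε≡g → ≡.trans (≡.cong (_^ q) (≡.sym ε≡g)) (ε^ q))
                         (λ g^q → ≡.sym (coprime-torsion coprime g^q g^n)))

sum-const : ∀ n a → Over.∑ n (λ _ → a) ≡ + n * a
sum-const zero    a = ≡.sym (ℤₚ.*-zeroˡ a)
sum-const (suc n) a = ≡.trans (≡.cong (_+_ a) (sum-const n a)) (≡.sym (ℤₚ.suc-* (+ n) a))

sum-∣ : ∀ {d} n {f : Fin n → ℤ} → (∀ i → d ∣ f i) → d ∣ Over.∑ n f
sum-∣ zero    d∣f = divides 0ℤ ≡.refl
sum-∣ (suc n) d∣f = ∣m∣n⇒∣m+n (d∣f zero) (sum-∣ n (d∣f ∘ suc))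

-- Projection onto the `m`-torsion and fibre sums.

-- The exponent `k` is 0 modulo `n` and 1 modulo `m`, as in the Chinese remainder theorem. Hence
-- `g ↦ g ^ k` is idempotent, with image the `m`-torsion and kernel the `n`-torsion.
module Projection {v : ℕ} (G : FiniteAbelianGroup v) {m n k i j : ℕ}
  (v≡mn : v ≡ m ℕ.* n) (k≡ni : k ≡ n ℕ.* i) (k≡1+mj : k ≡ suc (m ℕ.* j)) where
  open GroupPowers G
  open Powers G
  open Over v

  ^k-fixes : ∀ {a} → a ^ m ≡ ε → a ^ k ≡ a
  ^k-fixes {a} a^m = begin
    a ^ k              ≡⟨ ≡.cong (a ^_) k≡1+mj ⟩
    a ∙ a ^ (m ℕ.* j)  ≡⟨ ≡.cong (a ∙_) (^-∣ {a} {m} (ℕᵈ.m∣m*n j) a^m) ⟩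
    a ∙ ε              ≡⟨ identityʳ a ⟩
    a                  ∎
    where open ≡.≡-Reasoning

  ^k-torsion : ∀ g → (g ^ k) ^ m ≡ ε
  ^k-torsion g = ≡.trans (≡.sym (^-* g k m)) (^-∣ (ℕᵈ.divides i eq) (lagrange g))
    where
    open ≡.≡-Reasoning
    eq : k ℕ.* m ≡ i ℕ.* v
    eq = begin
      k ℕ.* m            ≡⟨ ≡.cong (ℕ._* m) (≡.trans k≡ni (ℕₚ.*-comm n i)) ⟩
      i ℕ.* n ℕ.* m      ≡⟨ ℕₚ.*-assoc i n m ⟩
      i ℕ.* (n ℕ.* m)    ≡⟨ ≡.cong (i ℕ.*_) (≡.trans (ℕₚ.*-comm n m) (≡.sym v≡mn)) ⟩
      i ℕ.* v            ∎

  ^n⇒^k : ∀ {z} → z ^ n ≡ ε → z ^ k ≡ ε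
  ^n⇒^k = ^-∣ (ℕᵈ.divides i (≡.trans k≡ni (ℕₚ.*-comm n i)))

  -- The element `z ^ n` is `m`-torsion, hence fixed by the `k`-th power, and that power can be
  -- moved onto `z`.
  ^k⇒^n : ∀ {z} → z ^ k ≡ ε → z ^ n ≡ ε
  ^k⇒^n {z} z^k = begin
    z ^ n          ≡⟨ ^k-fixes z^nm ⟨
    (z ^ n) ^ k    ≡⟨ ^-swap z n k ⟩
    (z ^ k) ^ n    ≡⟨ ≡.cong (_^ n) z^k ⟩
    ε ^ n          ≡⟨ ε^ n ⟩
    ε              ∎
    where
    open ≡.≡-Reasoning
    z^nm : (z ^ n) ^ m ≡ ε
    z^nm = ≡.trans (≡.sym (^-* z n m))
      (≡.trans (≡.cong (z ^_) (≡.trans (ℕₚ.*-comm n m) (≡.sym v≡mn))) (lagrange z))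

  -- The coefficient at `a` of the image of `f` under the projection; for `f = E` it is the number
  -- x(a).
  fibreSum : (Fin v → ℤ) → Fin v → ℤ
  fibreSum f a = ∑ (λ g → ⟦ g ^ k ≟ a ⟧ * f g)

  ∑-fibreSum-* : ∀ f (h : Fin v → ℤ) → ∑ (λ a → fibreSum f a * h a) ≡ ∑ (λ g → f g * h (g ^ k))
  ∑-fibreSum-* f h = begin
    ∑ (λ a → fibreSum f a * h a)
      ≡⟨ ∑-cong (λ a → ≡.trans (≡.sym (∑-*ʳ (λ g → ⟦ g ^ k ≟ a ⟧ * f g) (h a)))
           (∑-cong (λ g → ℤₚ.*-assoc ⟦ g ^ k ≟ a ⟧ (f g) (h a)))) ⟩
    ∑ (λ a → ∑ (λ g → ⟦ g ^ k ≟ a ⟧ * (f g * h a)))    ≡⟨ ∑-comm (λ a g → ⟦ g ^ k ≟ a ⟧ * (f g * h a)) ⟩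
    ∑ (λ g → ∑ (λ a → ⟦ g ^ k ≟ a ⟧ * (f g * h a)))    ≡⟨ ∑-cong (λ g → ∑-⟦⟧ (g ^ k) (λ a → f g * h a)) ⟩
    ∑ (λ g → f g * h (g ^ k))                          ∎
    where open ≡.≡-Reasoning

  ∑-fibreSum : ∀ f → ∑ (fibreSum f) ≡ ∑ f
  ∑-fibreSum f = begin
    ∑ (fibreSum f)                  ≡⟨ ∑-cong (λ a → ℤₚ.*-identityʳ (fibreSum f a)) ⟨
    ∑ (λ a → fibreSum f a * 1ℤ)     ≡⟨ ∑-fibreSum-* f (λ _ → 1ℤ) ⟩
    ∑ (λ g → f g * 1ℤ)              ≡⟨ ∑-cong (λ g → ℤₚ.*-identityʳ (f g)) ⟩
    ∑ f                             ∎
    where open ≡.≡-Reasoning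

  fibreSum-support : ∀ f a → torsion m a * fibreSum f a ≡ fibreSum f a
  fibreSum-support f a with a ^ m ≟ ε
  ... | yes _  = ℤₚ.*-identityˡ _
  ... | no ¬a^m = ≡.trans (ℤₚ.*-zeroˡ (fibreSum f a)) (≡.sym (≡.trans (∑-cong vanish) ∑-zero))
    where
    vanish : ∀ g → ⟦ g ^ k ≟ a ⟧ * f g ≡ 0ℤ
    vanish g = ≡.trans (≡.cong (_* f g) (⟦⟧-false (g ^ k ≟ a) (λ eq → ¬a^m (≡.subst (λ x → x ^ m ≡ ε) eq (^k-torsion g)))))
      (ℤₚ.*-zeroˡ (f g))

  same-fibre : ∀ g z → ⟦ (g ∙ z) ^ k ≟ g ^ k ⟧ ≡ torsion n z
  same-fibre g z = ⟦⟧-cong ((g ∙ z) ^ k ≟ g ^ k) (z ^ n ≟ ε)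
    (λ eq → ^k⇒^n (∙-cancelˡ (g ^ k) _ _ (≡.trans (≡.sym (^-∙ g z k)) (≡.trans eq (≡.sym (identityʳ _))))))
    (λ z^n → ≡.trans (^-∙ g z k) (≡.trans (≡.cong (g ^ k ∙_) (^n⇒^k z^n)) (identityʳ _)))

  -- The group is counted along the projection: every point of the image has a coset of the
  -- `n`-torsion as its fibre.
  ∣torsion∣-* : ∣torsion∣ m * ∣torsion∣ n ≡ + v
  ∣torsion∣-* = begin
    ∣torsion∣ m * ∣torsion∣ n                     ≡⟨ ∑-*ʳ (torsion m) (∣torsion∣ n) ⟨
    ∑ (λ a → torsion m a * ∣torsion∣ n)           ≡⟨ ∑-cong (λ a → ⟦⟧-* (a ^ m ≟ ε) (fibre-size a)) ⟩
    ∑ (λ a → torsion m a * fibreSum (λ _ → 1ℤ) a) ≡⟨ ∑-cong (fibreSum-support (λ _ → 1ℤ)) ⟩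
    ∑ (fibreSum (λ _ → 1ℤ))                       ≡⟨ ∑-fibreSum (λ _ → 1ℤ) ⟩
    ∑ (λ _ → 1ℤ)                                  ≡⟨ sum-const v 1ℤ ⟩
    + v * 1ℤ                                      ≡⟨ ℤₚ.*-identityʳ (+ v) ⟩
    + v                                           ∎
    where
    open ≡.≡-Reasoning
    fibre-size : ∀ a → a ^ m ≡ ε → ∣torsion∣ n ≡ fibreSum (λ _ → 1ℤ) a
    fibre-size a a^m = ≡.sym (begin
      fibreSum (λ _ → 1ℤ) a                     ≡⟨ ∑-permute (λ g → ⟦ g ^ k ≟ a ⟧ * 1ℤ) (translation a) ⟩
      ∑ (λ z → ⟦ (a ∙ z) ^ k ≟ a ⟧ * 1ℤ)        ≡⟨ ∑-cong (λ z → ℤₚ.*-identityʳ ⟦ (a ∙ z) ^ k ≟ a ⟧) ⟩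
      ∑ (λ z → ⟦ (a ∙ z) ^ k ≟ a ⟧)             ≡⟨ ∑-cong (λ z → ≡.cong (λ b → ⟦ (a ∙ z) ^ k ≟ b ⟧) (^k-fixes a^m)) ⟨
      ∑ (λ z → ⟦ (a ∙ z) ^ k ≟ a ^ k ⟧)         ≡⟨ ∑-cong (same-fibre a) ⟩
      ∣torsion∣ n                               ∎)

  module _ (f : Fin v → ℤ) (f-sym : ∀ g → f (g ⁻¹) ≡ f g) (κ c : ℤ) (square : SquaresTo G f κ c) where

    autocorrelation : ∀ z → ∑ (λ g → f g * f (g ∙ z)) ≡ κ * ⟦ ε ≟ z ⟧ + c
    autocorrelation z = begin
      ∑ (λ g → f g * f (g ∙ z))                          ≡⟨ ∑-permute (λ g → f g * f (g ∙ z)) (reflection ε) ⟩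
      ∑ (λ g → f (g ⁻¹ ∙ ε) * f ((g ⁻¹ ∙ ε) ∙ z))        ≡⟨ ∑-cong (λ g → ≡.cong (λ h → f h * f (h ∙ z)) (identityʳ (g ⁻¹))) ⟩
      ∑ (λ g → f (g ⁻¹) * f (g ⁻¹ ∙ z))                  ≡⟨ ∑-cong (λ g → ≡.cong (_* f (g ⁻¹ ∙ z)) (f-sym g)) ⟩
      ∑ (λ g → f g * f (g ⁻¹ ∙ z))                       ≡⟨ square z ⟩
      κ * ⟦ ε ≟ z ⟧ + c                                  ∎
      where open ≡.≡-Reasoning

    -- The left-hand side sums `f g * f (g ∙ z)` over all `g` and all `n`-torsion `z`, since two
    -- points share a fibre exactly when they differ by such a `z`. For fixed `z` the sum over `g`
    -- is an autocorrelation, and `κ` enters only at `z ≡ ε`.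
    ∑-fibreSum² : ∑ (λ a → fibreSum f a * fibreSum f a) ≡ κ + c * ∣torsion∣ n
    ∑-fibreSum² = begin
      ∑ (λ a → fibreSum f a * fibreSum f a)                       ≡⟨ ∑-fibreSum-* f (fibreSum f) ⟩
      ∑ (λ g → f g * fibreSum f (g ^ k))                          ≡⟨ ∑-cong (λ g → ≡.cong (f g *_) (shift g)) ⟩
      ∑ (λ g → f g * ∑ (λ z → torsion n z * f (g ∙ z)))
        ≡⟨ ∑-cong (λ g → ∑-*ˡ (f g) (λ z → torsion n z * f (g ∙ z))) ⟨
      ∑ (λ g → ∑ (λ z → f g * (torsion n z * f (g ∙ z))))         ≡⟨ ∑-comm (λ g z → f g * (torsion n z * f (g ∙ z))) ⟩
      ∑ (λ z → ∑ (λ g → f g * (torsion n z * f (g ∙ z))))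
        ≡⟨ ∑-cong (λ z → ≡.trans (∑-cong (λ g → swap (f g) (torsion n z) (f (g ∙ z))))
             (∑-*ˡ (torsion n z) (λ g → f g * f (g ∙ z)))) ⟩
      ∑ (λ z → torsion n z * ∑ (λ g → f g * f (g ∙ z)))           ≡⟨ ∑-cong (λ z → ≡.cong (torsion n z *_) (autocorrelation z)) ⟩
      ∑ (λ z → torsion n z * (κ * ⟦ ε ≟ z ⟧ + c))                 ≡⟨ ∑-cong (λ z → expand (torsion n z) κ ⟦ ε ≟ z ⟧ c) ⟩
      ∑ (λ z → ⟦ ε ≟ z ⟧ * (κ * torsion n z) + c * torsion n z)
        ≡⟨ ∑-+ (λ z → ⟦ ε ≟ z ⟧ * (κ * torsion n z)) (λ z → c * torsion n z) ⟩
      ∑ (λ z → ⟦ ε ≟ z ⟧ * (κ * torsion n z)) + ∑ (λ z → c * torsion n z)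
        ≡⟨ ≡.cong₂ _+_ (∑-⟦⟧ ε (λ z → κ * torsion n z)) (∑-*ˡ c (torsion n)) ⟩
      κ * torsion n ε + c * ∣torsion∣ n
        ≡⟨ ≡.cong (λ t → κ * t + c * ∣torsion∣ n) (⟦⟧-true (ε ^ n ≟ ε) (ε^ n)) ⟩
      κ * 1ℤ + c * ∣torsion∣ n                                    ≡⟨ ≡.cong (_+ c * ∣torsion∣ n) (ℤₚ.*-identityʳ κ) ⟩
      κ + c * ∣torsion∣ n                                         ∎
      where
      open ≡.≡-Reasoning
      swap : ∀ a b c → a * (b * c) ≡ b * (a * c)
      swap = solve-∀
      expand : ∀ t k d c → t * (k * d + c) ≡ d * (k * t) + c * t
      expand = solve-∀
      shift : ∀ g → fibreSum f (g ^ k) ≡ ∑ (λ z → torsion n z * f (g ∙ z))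
      shift g = ≡.trans (∑-permute (λ h → ⟦ h ^ k ≟ g ^ k ⟧ * f h) (translation g))
        (∑-cong (λ z → ≡.cong (_* f (g ∙ z)) (same-fibre g z)))

  -- The `k`-th power factors through the `q`-th power, so each of its fibres is a union of fibres
  -- of the latter.
  fibreSum-∣ : ∀ {d} q l f → k ≡ q ℕ.* l → (∀ x → d ∣ ∑ (λ g → ⟦ g ^ q ≟ x ⟧ * f g)) → ∀ a → d ∣ fibreSum f a
  fibreSum-∣ {d} q l f k≡ql d∣ a = ≡.subst (d ∣_) eq (sum-∣ v (λ y → ∣n⇒∣m*n ⟦ y ^ l ≟ a ⟧ (d∣ y)))
    where
    open ≡.≡-Reasoning
    swap : ∀ a b c → a * (b * c) ≡ b * (a * c)
    swap = solve-∀
    eq : ∑ (λ y → ⟦ y ^ l ≟ a ⟧ * ∑ (λ g → ⟦ g ^ q ≟ y ⟧ * f g)) ≡ fibreSum f a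
    eq = begin
      ∑ (λ y → ⟦ y ^ l ≟ a ⟧ * ∑ (λ g → ⟦ g ^ q ≟ y ⟧ * f g))
        ≡⟨ ∑-cong (λ y → ≡.trans (≡.sym (∑-*ˡ ⟦ y ^ l ≟ a ⟧ (λ g → ⟦ g ^ q ≟ y ⟧ * f g)))
             (∑-cong (λ g → swap ⟦ y ^ l ≟ a ⟧ ⟦ g ^ q ≟ y ⟧ (f g)))) ⟩
      ∑ (λ y → ∑ (λ g → ⟦ g ^ q ≟ y ⟧ * (⟦ y ^ l ≟ a ⟧ * f g)))
        ≡⟨ ∑-comm (λ y g → ⟦ g ^ q ≟ y ⟧ * (⟦ y ^ l ≟ a ⟧ * f g)) ⟩
      ∑ (λ g → ∑ (λ y → ⟦ g ^ q ≟ y ⟧ * (⟦ y ^ l ≟ a ⟧ * f g)))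
        ≡⟨ ∑-cong (λ g → ∑-⟦⟧ (g ^ q) (λ y → ⟦ y ^ l ≟ a ⟧ * f g)) ⟩
      ∑ (λ g → ⟦ (g ^ q) ^ l ≟ a ⟧ * f g)
        ≡⟨ ∑-cong (λ g → ≡.cong (λ h → ⟦ h ≟ a ⟧ * f g) (≡.trans (≡.cong (g ^_) k≡ql) (^-* g q l))) ⟨
      fibreSum f a ∎

-- Weighted counting under a free action.

argmin : ∀ {n} (f : Fin (suc n) → ℕ) → ∃ λ i → ∀ j → f i ℕ.≤ f j
argmin {zero}  f = zero , λ { zero → ℕₚ.≤-refl }
argmin {suc n} f with argmin (f ∘ suc)
... | i , least with ℕₚ.≤-total (f zero) (f (suc i))
...   | inj₁ f0≤ = zero , λ { zero → ℕₚ.≤-refl ; (suc j) → ℕₚ.≤-trans f0≤ (least j) }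
...   | inj₂ ≤f0 = suc i , λ { zero → ≤f0 ; (suc j) → least j }

-- Every orbit of a free action has exactly one element that is minimal in its
-- orbit; summing over t the invariant weight of the points moved by t to such
-- an element counts every point once, and gives the same amount for each t.
module FreeAction {v N} (π : Fin (suc N) → Permutation v v)
  (closed : ∀ s t → ∃ λ u → ∀ g → π s ⟨$⟩ʳ (π t ⟨$⟩ʳ g) ≡ π u ⟨$⟩ʳ g)
  (transitive : ∀ s t → ∃ λ u → ∀ g → π u ⟨$⟩ʳ (π t ⟨$⟩ʳ g) ≡ π s ⟨$⟩ʳ g)
  (w : Fin v → ℤ) (invariant : ∀ t g → w (π t ⟨$⟩ʳ g) ≡ w g)
  (free : ∀ {g} → ¬ (w g ≡ 0ℤ) → ∀ {s t} → π s ⟨$⟩ʳ g ≡ π t ⟨$⟩ʳ g → s ≡ t) where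

  open Over v using (∑; ∑-cong; ∑-permute)
  open import Algebra.Properties.Semiring.Sum ℤₚ.+-*-semiring using (sum; sum-cong-≗; ∑-comm)

  Minimal : Fin v → Set
  Minimal g = ∀ t → toℕ g ℕ.≤ toℕ (π t ⟨$⟩ʳ g)

  minimal? : ∀ g → Dec (Minimal g)
  minimal? g = all? (λ t → toℕ g ℕ.≤? toℕ (π t ⟨$⟩ʳ g))

  minimal-unique : ∀ {g s t} → Minimal (π s ⟨$⟩ʳ g) → Minimal (π t ⟨$⟩ʳ g) → π s ⟨$⟩ʳ g ≡ π t ⟨$⟩ʳ g
  minimal-unique {g} {s} {t} ms mt = toℕ-injective (ℕₚ.≤-antisym (below ms t) (below mt s))
    where
    below : ∀ {s} → Minimal (π s ⟨$⟩ʳ g) → ∀ t → toℕ (π s ⟨$⟩ʳ g) ℕ.≤ toℕ (π t ⟨$⟩ʳ g)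
    below {s} ms t with transitive t s
    ... | u , eq = ≡.subst (λ h → toℕ (π s ⟨$⟩ʳ g) ℕ.≤ toℕ h) (eq g) (ms u)

  minimal-exists : ∀ g → ∃ λ t → Minimal (π t ⟨$⟩ʳ g)
  minimal-exists g with argmin (λ t → toℕ (π t ⟨$⟩ʳ g))
  ... | t , least = t , λ s → let u , eq = closed s t in
    ≡.subst (λ h → toℕ (π t ⟨$⟩ʳ g) ℕ.≤ toℕ h) (≡.sym (eq g)) (least u)

  weight-once : ∀ g → sum (λ t → w g * ⟦ minimal? (π t ⟨$⟩ʳ g) ⟧) ≡ w g
  -- Freeness is assumed only where the weight is nonzero, so points of weight zero are set aside.
  weight-once g with w g ℤ.≟ 0ℤ
  ... | yes w≡0 = ≡.trans (sum-cong-≗ (λ t → ≡.trans (≡.cong (_* ⟦ minimal? (π t ⟨$⟩ʳ g) ⟧) w≡0) (ℤₚ.*-zeroˡ ⟦ minimal? (π t ⟨$⟩ʳ g) ⟧)))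
                    (≡.trans (Over.∑-zero (suc N)) (≡.sym w≡0))
  ... | no  w≢0 with minimal-exists g
  ...   | t₀ , min₀ = ≡.trans (sum-cong-≗ (λ t → ≡.trans (ℤₚ.*-comm (w g) ⟦ minimal? (π t ⟨$⟩ʳ g) ⟧)
                        (≡.cong (_* w g) (⟦⟧-cong (minimal? (π t ⟨$⟩ʳ g)) (t₀ ≟ t)
                          (λ min → free w≢0 (minimal-unique min₀ min))
                          (λ t₀≡t → ≡.subst (λ t → Minimal (π t ⟨$⟩ʳ g)) t₀≡t min₀)))))
                        (sum-⟦⟧ t₀ (λ _ → w g))

  order∣∑ : + suc N ∣ ∑ w
  order∣∑ = divides (∑ (λ g → w g * ⟦ minimal? g ⟧)) (begin
    ∑ w                                                          ≡⟨ ∑-cong weight-once ⟨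
    ∑ (λ g → sum (λ t → w g * ⟦ minimal? (π t ⟨$⟩ʳ g) ⟧))        ≡⟨ ∑-comm (λ g t → w g * ⟦ minimal? (π t ⟨$⟩ʳ g) ⟧) ⟩
    sum (λ t → ∑ (λ g → w g * ⟦ minimal? (π t ⟨$⟩ʳ g) ⟧))
      ≡⟨ sum-cong-≗ (λ t → ∑-cong (λ g → ≡.cong (_* ⟦ minimal? (π t ⟨$⟩ʳ g) ⟧) (invariant t g))) ⟨
    sum (λ t → ∑ (λ g → w (π t ⟨$⟩ʳ g) * ⟦ minimal? (π t ⟨$⟩ʳ g) ⟧))
      ≡⟨ sum-cong-≗ (λ t → ∑-permute (λ g → w g * ⟦ minimal? g ⟧) (π t)) ⟨
    sum {suc N} (λ t → ∑ (λ g → w g * ⟦ minimal? g ⟧))           ≡⟨ sum-const (suc N) _ ⟩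
    + suc N * ∑ (λ g → w g * ⟦ minimal? g ⟧)                     ≡⟨ ℤₚ.*-comm (+ suc N) _ ⟩
    ∑ (λ g → w g * ⟦ minimal? g ⟧) * + suc N                     ∎)
    where open ≡.≡-Reasoning

-- Divisibility, odd squares and congruences between `p`-th powers.

prime∤⇒coprime : ∀ {q n} → Prime q → ¬ (q ℕᵈ.∣ n) → Coprime q n
prime∤⇒coprime prime-q q∤n (d∣q , d∣n) with prime⇒irreducible prime-q d∣q
... | inj₁ d≡1 = d≡1
... | inj₂ ≡.refl = contradiction d∣n q∤n

prime∣^⇒∣ : ∀ {q} → Prime q → ∀ a n → q ℕᵈ.∣ a ℕ.^ n → q ℕᵈ.∣ a
prime∣^⇒∣ prime-q a zero    q∣1 = contradiction (≡.subst Prime (ℕᵈ.∣1⇒≡1 q∣1) prime-q) ¬prime[1]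
prime∣^⇒∣ prime-q a (suc n) q∣ = [ (λ x → x) , prime∣^⇒∣ prime-q a n ]′ (euclidsLemma a (a ℕ.^ n) prime-q q∣)

coprime-*-∣ : ∀ {m n k} → Coprime n m → m ℕᵈ.∣ k → n ℕᵈ.∣ k → m ℕ.* n ℕᵈ.∣ k
coprime-*-∣ {m} {n} coprime (ℕᵈ.divides d ≡.refl) n∣k =
  ≡.subst (m ℕ.* n ℕᵈ.∣_) (ℕₚ.*-comm m d)
    (ℕᵈ.*-monoʳ-∣ m (coprime-divisor coprime (≡.subst (n ℕᵈ.∣_) (ℕₚ.*-comm d m) n∣k)))

-- Passing from `2 r + 1` to `2 r + 3` increases the square by `8 (r + 1)`.
odd-square : ∀ r → ∃ λ j → suc (r ℕ.* 2) ℕ.* suc (r ℕ.* 2) ≡ suc (8 ℕ.* j)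
odd-square zero    = 0 , ≡.refl
odd-square (suc r) with odd-square r
... | j , eq = suc (j ℕ.+ r) , ≡.trans (square+ r) (≡.trans (≡.cong (ℕ._+ 8 ℕ.* suc r) eq) (regroup j r))
  where
  square+ : ∀ r → suc (suc r ℕ.* 2) ℕ.* suc (suc r ℕ.* 2) ≡ suc (r ℕ.* 2) ℕ.* suc (r ℕ.* 2) ℕ.+ 8 ℕ.* suc r
  square+ = ℕ-Solver.solve-∀
  regroup : ∀ j r → suc (8 ℕ.* j) ℕ.+ 8 ℕ.* suc r ≡ suc (8 ℕ.* suc (j ℕ.+ r))
  regroup = ℕ-Solver.solve-∀

pos-^ : ∀ a n → + (a ℕ.^ n) ≡ (+ a) ℤ.^ n
pos-^ a zero    = ≡.refl
pos-^ a (suc n) = ≡.trans (ℤₚ.pos-* a (a ℕ.^ n)) (≡.cong (+ a *_) (pos-^ a n))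

-- The sum a^(r-1) + a^(r-2) b + ... + b^(r-1), the cofactor of a - b in a^r - b^r.
geometric : ℤ → ℤ → ℕ → ℤ
geometric a b zero    = 0ℤ
geometric a b (suc r) = a ℤ.^ r + b * geometric a b r

geometric-difference : ∀ a b r → (a - b) * geometric a b r ≡ a ℤ.^ r - b ℤ.^ r
geometric-difference a b zero    = ℤₚ.*-zeroʳ (a - b)
geometric-difference a b (suc r) = begin
  (a - b) * (a ℤ.^ r + b * geometric a b r)             ≡⟨ expand a b (a ℤ.^ r) (geometric a b r) ⟩
  (a - b) * a ℤ.^ r + b * ((a - b) * geometric a b r)   ≡⟨ ≡.cong (λ x → (a - b) * a ℤ.^ r + b * x) (geometric-difference a b r) ⟩
  (a - b) * a ℤ.^ r + b * (a ℤ.^ r - b ℤ.^ r)           ≡⟨ collect a b (a ℤ.^ r) (b ℤ.^ r) ⟩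
  a * a ℤ.^ r - b * b ℤ.^ r                             ∎
  where
  open ≡.≡-Reasoning
  expand : ∀ a b x y → (a - b) * (x + b * y) ≡ (a - b) * x + b * ((a - b) * y)
  expand = solve-∀
  collect : ∀ a b x y → (a - b) * x + b * (x - y) ≡ a * x - b * y
  collect = solve-∀

module _ {n : ℕ} where
  open ModN n

  geometric-mod : ∀ {a b} → a ≡ b [mod n ] → ∀ r → geometric a b (suc r) ≡ + suc r * a ℤ.^ r [mod n ]
  geometric-mod {a} {b} a≡b zero    = ≡⇒≡[mod] (≡.cong (_+_ 1ℤ) (ℤₚ.*-zeroʳ b))
  geometric-mod {a} {b} a≡b (suc r) =
    mod-trans (mod-+ (≡⇒≡[mod] {a ℤ.^ suc r} ≡.refl) (mod-* (mod-sym a≡b) (geometric-mod a≡b r)))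
      (≡⇒≡[mod] (collect (+ suc r) a (a ℤ.^ r)))
    where
    collect : ∀ k a x → a * x + a * (k * x) ≡ (1ℤ + k) * (a * x)
    collect = solve-∀

mod-lower : ∀ {a b m n} → m ℕᵈ.∣ n → a ≡ b [mod n ] → a ≡ b [mod m ]
mod-lower m∣n (congruent n∣) = congruent (∣ᵤ⇒∣ (ℕᵈ.∣-trans m∣n (∣⇒∣ᵤ n∣)))

-- The cofactor of `a - b` in the difference of `p`-th powers is `p * a ^ (p - 1)` modulo `p`, hence
-- 0. It supplies the extra factor `p` in the modulus.
^p-mod : ∀ {p n a b} → .{{NonZero p}} → p ℕᵈ.∣ n → a ≡ b [mod n ] → a ℤ.^ p ≡ b ℤ.^ p [mod n ℕ.* p ]
^p-mod {p@(suc r)} {n} {a} {b} p∣n a≡b@(congruent (divides x eqx)) with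
  ModN.≡0⇒∣ p (ModN.mod-trans p (geometric-mod (mod-lower p∣n a≡b) r) (ModN.∣⇒≡0 p (∣m⇒∣m*n (a ℤ.^ r) (divides 1ℤ (≡.sym (ℤₚ.*-identityˡ (+ p)))))))
... | divides y eqy = congruent (divides (x * y) (begin
  a ℤ.^ p - b ℤ.^ p              ≡⟨ geometric-difference a b p ⟨
  (a - b) * geometric a b p      ≡⟨ ≡.cong₂ _*_ eqx eqy ⟩
  (x * + n) * (y * + p)          ≡⟨ collect x y (+ n) (+ p) ⟩
  (x * y) * (+ n * + p)          ≡⟨ ≡.cong (x * y *_) (ℤₚ.pos-* n p) ⟨
  (x * y) * + (n ℕ.* p)          ∎))
  where
  open ≡.≡-Reasoning
  collect : ∀ x y n p → (x * n) * (y * p) ≡ (x * y) * (n * p)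
  collect = solve-∀

odd⇒suc-double : ∀ n → ¬ (2 ℕᵈ.∣ n) → ∃ λ m → n ≡ suc (m ℕ.* 2)
odd⇒suc-double zero          odd = contradiction (ℕᵈ.divides 0 ≡.refl) odd
odd⇒suc-double (suc zero)    odd = 0 , ≡.refl
odd⇒suc-double (suc (suc n)) odd with odd⇒suc-double n (λ { (ℕᵈ.divides d eq) → odd (ℕᵈ.divides (suc d) (≡.cong (2 ℕ.+_) eq)) })
... | m , eq = suc m , ≡.cong (2 ℕ.+_) eq

prime∣prime⇒≡ : ∀ {q r} → Prime q → Prime r → q ℕᵈ.∣ r → q ≡ r
prime∣prime⇒≡ prime-q prime-r q∣r with prime⇒irreducible prime-r q∣r
... | inj₁ q≡1 = contradiction (≡.subst Prime q≡1 prime-q) ¬prime[1]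
... | inj₂ q≡r = q≡r

^-odd : ∀ a m → a ℤ.^ suc (m ℕ.* 2) ≡ a * (a * a) ℤ.^ m
^-odd a zero    = ≡.refl
^-odd a (suc m) = ≡.trans (≡.cong (λ x → a * (a * x)) (^-odd a m)) (regroup a ((a * a) ℤ.^ m))
  where
  regroup : ∀ a x → a * (a * (a * x)) ≡ a * ((a * a) * x)
  regroup = solve-∀

-- Multipliers of `E`.

module _ {v : ℕ} (G : FiniteAbelianGroup v) (E : Fin v → ℤ) (trit : ∀ g → Trit (E g)) (b : ℕ) (c : ℤ)
  (square : SquaresTo G E (+ b * + b) c) where
  open GroupPowers G
  open Powers G

  prime-multiplier : ∀ {q} → Prime q → ¬ (2 ℕᵈ.∣ q) → ¬ (q ℕᵈ.∣ v) → ¬ (q ℕᵈ.∣ b) → ∀ g → E (g ^ q) ≡ E g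
  prime-multiplier {q} prime-q odd q∤v q∤b g with odd⇒suc-double q odd
  ... | m , q≡1+2m = ≡.sym (trit-≡ (trit g) (trit (g ^ q)) 3≤q
    (ScalarSquare.multiplier-mod G E (+ b * + b) c square prime-q
      (λ h → ≡⇒≡[mod] (≡.trans (≡.cong (E h ℤ.^_) q≡1+2m) (trit-^odd (trit h) m)))
      (^-coprime-injective (prime∤⇒coprime prime-q q∤v) (lagrange _) (lagrange _))
      (ε^ q) m q≡1+2m κ^m≡1 g))
    where
    open ModN q
    3≤q : 3 ℕ.≤ q
    3≤q = ℕₚ.≤∧≢⇒< (ℕ.nonTrivial⇒n>1 q {{prime⇒nonTrivial prime-q}}) (λ 2≡q → odd (ℕᵈ.∣-reflexive 2≡q))
    -- Since `q = 1 + 2 m`, this power is `b ^ (q - 1)`: Fermat's little theorem with one factor `b`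
    -- cancelled.
    κ^m≡1 : (+ b * + b) ℤ.^ m ≡ 1ℤ [mod q ]
    κ^m≡1 with euclid prime-q (+ b) ((+ b * + b) ℤ.^ m - 1ℤ)
      (≡.subst (+ q ∣_) (factor (+ b) ((+ b * + b) ℤ.^ m))
        (≡.subst (λ x → + q ∣ x - + b) (≡.trans (≡.cong ((+ b) ℤ.^_) q≡1+2m) (^-odd (+ b) m)) (n∣a-b (fermat prime-q b))))
      where
      factor : ∀ b k → b * k - b ≡ b * (k - 1ℤ)
      factor = solve-∀
    ... | inj₁ q∣b = contradiction (∣⇒∣ᵤ q∣b) q∤b
    ... | inj₂ q∣  = congruent q∣

  -- Multipliers are closed under products, so the prime factors of `s` can be treated one at a
  -- time.
  multiplier : ∀ s → .{{NonZero s}} → (∀ {q} → Prime q → q ℕᵈ.∣ s → ¬ (2 ℕᵈ.∣ q) × ¬ (q ℕᵈ.∣ v) × ¬ (q ℕᵈ.∣ b)) →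
    ∀ g → E (g ^ s) ≡ E g
  multiplier s good g = ≡.trans (≡.cong (λ n → E (g ^ n)) (isFactorisation)) (go factors factorsPrime
      (λ pq q∣ → good pq (≡.subst (_ ℕᵈ.∣_) (≡.sym isFactorisation) q∣)) g)
    where
    open PrimeFactorisation (factorise s)
    go : ∀ qs → All Prime qs →
      (∀ {q} → Prime q → q ℕᵈ.∣ ℕL.product qs → ¬ (2 ℕᵈ.∣ q) × ¬ (q ℕᵈ.∣ v) × ¬ (q ℕᵈ.∣ b)) →
      ∀ g → E (g ^ ℕL.product qs) ≡ E g
    go []       []         good g = ≡.cong E (identityʳ g)
    go (q ∷ qs) (pq ∷ pqs) good g with good pq (ℕᵈ.m∣m*n (ℕL.product qs))
    ... | odd , q∤v , q∤b = begin
      E (g ^ (q ℕ.* ℕL.product qs))    ≡⟨ ≡.cong E (^-* g q (ℕL.product qs)) ⟩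
      E ((g ^ q) ^ ℕL.product qs)      ≡⟨ go qs pqs (λ pr r∣ → good pr (ℕᵈ.∣n⇒∣m*n q r∣)) (g ^ q) ⟩
      E (g ^ q)                        ≡⟨ prime-multiplier pq odd q∤v q∤b g ⟩
      E g                              ∎
      where open ≡.≡-Reasoning

-- Exponents modulo the group order.

module _ {v : ℕ} (G : FiniteAbelianGroup v) where
  open GroupPowers G
  open Powers G

  ^-mod : ∀ g {m n} → + m ≡ + n [mod v ] → g ^ m ≡ g ^ n
  ^-mod g {m} {n} (congruent (divides (+ d) eq)) = begin
    g ^ m                      ≡⟨ ≡.cong (g ^_) (ℤₚ.+-injective m≡) ⟩
    g ^ (n ℕ.+ d ℕ.* v)        ≡⟨ ^-+ g n (d ℕ.* v) ⟩
    g ^ n ∙ g ^ (d ℕ.* v)      ≡⟨ ≡.cong (g ^ n ∙_) (^-∣ {g} {v} (ℕᵈ.n∣m*n d) (lagrange g)) ⟩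
    g ^ n ∙ ε                  ≡⟨ identityʳ _ ⟩
    g ^ n                      ∎
    where
    open ≡.≡-Reasoning
    split : ∀ m n → m ≡ n + (m - n)
    split = solve-∀
    m≡ : + m ≡ + (n ℕ.+ d ℕ.* v)
    m≡ = ≡.trans (split (+ m) (+ n)) (≡.cong (_+_ (+ n)) (≡.trans eq (≡.sym (ℤₚ.pos-* d v))))
  ^-mod g {m} {n} (congruent (divides -[1+ d ] eq)) =
    ≡.sym (^-mod g {n} {m} (congruent (divides (+ suc d) (≡.trans (negate (+ m) (+ n))
      (≡.trans (≡.cong -_ eq) (ℤₚ.neg-distribˡ-* -[1+ d ] (+ v)))))))
    where
    negate : ∀ m n → n - m ≡ - (m - n)
    negate = solve-∀

  ^-≡⇒difference : ∀ g m n → g ^ m ≡ g ^ n → ∃ λ d → g ^ d ≡ ε × (+ d ≡ + m - + n ⊎ + d ≡ + n - + m)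
  ^-≡⇒difference g m n eq with ℕₚ.≤-total m n
  ... | inj₁ m≤n with ℕₚ.m≤n⇒∃[o]m+o≡n m≤n
  ...   | d , ≡.refl = d , ∙-cancelˡ (g ^ m) _ _ (≡.trans (≡.sym (^-+ g m d)) (≡.trans (≡.sym eq) (≡.sym (identityʳ _))))
                         , inj₂ (difference (+ m) (+ d))
    where
    difference : ∀ m d → d ≡ (m + d) - m
    difference = solve-∀
  ^-≡⇒difference g m n eq | inj₂ n≤m with ℕₚ.m≤n⇒∃[o]m+o≡n n≤m
  ...   | d , ≡.refl = d , ∙-cancelˡ (g ^ n) _ _ (≡.trans (≡.sym (^-+ g n d)) (≡.trans eq (≡.sym (identityʳ _))))
                         , inj₁ (difference (+ n) (+ d))
    where
    difference : ∀ m d → d ≡ (m + d) - m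
    difference = solve-∀

-- Roots of unity modulo `8 * p ^ 3`.

-- As `suc N` is `p - 1`, the indices label the nonzero residues modulo `p`. Each is lifted to an
-- exponent that is 1 modulo 8 and multiplicative modulo the group order, which gives an action of
-- the units of ℤ/p on the group by powers.
module Teichmüller {p N j : ℕ} (prime-p : Prime p) (p≡2+N : p ≡ 2 ℕ.+ N) (p²≡1+8j : p ℕ.* p ≡ suc (8 ℕ.* j)) where
  open ModN

  private
    refl-mod : ∀ n a → a ≡ a [mod n ]
    refl-mod n a = ≡⇒≡[mod] n ≡.refl

  +m+n*o≡m : ∀ m n o → + (m ℕ.+ n ℕ.* o) ≡ + m [mod o ]
  +m+n*o≡m m n o = congruent (divides (+ n) (≡.trans (≡.cong (λ x → (+ m + x) - + m) (ℤₚ.pos-* n o)) (cancel (+ m) (+ n * + o))))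
    where
    cancel : ∀ a b → (a + b) - a ≡ b
    cancel = solve-∀

  instance
    p≢0 : NonZero p
    p≢0 = prime⇒nonZero prime-p

  -- Abstract, so that integer arithmetic does not unfold on successors.
  abstract
    unit : Fin (suc N) → ℕ
    unit t = suc (toℕ t)

    unit-zero : unit zero ≡ 1
    unit-zero = ≡.refl

    unit<p : ∀ t → unit t ℕ.< p
    unit<p t = ≡.subst (unit t ℕ.<_) (≡.sym p≡2+N) (ℕ.s≤s (toℕ<n t))

    ∤unit : ∀ t → ¬ (p ℕᵈ.∣ unit t)
    ∤unit t p∣ = ℕₚ.<⇒≱ (unit<p t) (ℕᵈ.∣⇒≤ p∣)

    residue : ∀ n → ¬ (p ℕᵈ.∣ n) → ∃ λ t → + n ≡ + unit t [mod p ]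
    residue n p∤n with n % p in eq | m%n<n n p
    ... | zero  | _   = contradiction (ℕᵈ.m%n≡0⇒n∣m n p eq) p∤n
    ... | suc r | r<p = fromℕ< r<1+N ,
      ≡.subst₂ (λ x y → + x ≡ + y [mod p ])
        (≡.sym (≡.trans (m≡m%n+[m/n]*n n p) (≡.cong (ℕ._+ n / p ℕ.* p) eq)))
        (≡.cong suc (≡.sym (toℕ-fromℕ< r<1+N)))
        (+m+n*o≡m (suc r) (n / p) p)
      where
      r<1+N : r ℕ.< suc N
      r<1+N = ℕ.s≤s⁻¹ (≡.subst (suc r ℕ.<_) p≡2+N r<p)

    unit-injective : ∀ {s t} → + unit s ≡ + unit t [mod p ] → s ≡ t
    unit-injective {s} {t} (congruent p∣) = toℕ-injective (ℕₚ.suc-injective (ℤₚ.+-injective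
      (ℤₚ.i-j≡0⇒i≡j (+ unit s) (+ unit t) (ℤₚ.∣i∣≡0⇒i≡0 (small _ (∣⇒∣ᵤ p∣) bound)))))
      where
      small : ∀ d → p ℕᵈ.∣ d → d ℕ.< p → d ≡ 0
      small zero    _   _   = ≡.refl
      small (suc d) p∣d d<p = contradiction (ℕᵈ.∣⇒≤ p∣d) (ℕₚ.<⇒≱ d<p)
      bound : ℤ.∣ + unit s - + unit t ∣ ℕ.< p
      bound = ℕₚ.≤-<-trans (ℤₚ.∣m⊝n∣≤m⊔n (unit s) (unit t)) (ℕₚ.⊔-pres-<m (unit<p s) (unit<p t))

  unit-* : ∀ s t → ∃ λ u → + unit s * + unit t ≡ + unit u [mod p ]
  unit-* s t =
    let u , eq = residue (unit s ℕ.* unit t) (λ p∣ → [ ∤unit s , ∤unit t ]′ (euclidsLemma (unit s) (unit t) prime-p p∣))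
    in u , ≡.subst (_≡ + unit u [mod p ]) (ℤₚ.pos-* (unit s) (unit t)) eq

  fermat-inverse : ∀ a → a ℤ.^ p ≡ a [mod p ] → ¬ (+ p ∣ a) → a ℤ.^ N * a ≡ 1ℤ [mod p ]
  fermat-inverse a (congruent p∣a^p-a) p∤a =
    [ (λ p∣a → contradiction p∣a p∤a) , congruent ]′ (euclid prime-p a (a ℤ.^ N * a - 1ℤ) (≡.subst (+ p ∣_) eq p∣a^p-a))
    where
    factor : ∀ a x → a * (a * x) - a ≡ a * (x * a - 1ℤ)
    factor = solve-∀
    a^2+N : a ℤ.^ (2 ℕ.+ N) ≡ a * (a * a ℤ.^ N)
    a^2+N = ≡.refl
    open ≡.≡-Reasoning
    eq : a ℤ.^ p - a ≡ a * (a ℤ.^ N * a - 1ℤ)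
    eq = begin
      a ℤ.^ p - a                   ≡⟨ ≡.cong (λ n → a ℤ.^ n - a) p≡2+N ⟩
      a ℤ.^ (2 ℕ.+ N) - a           ≡⟨ ≡.cong (_- a) a^2+N ⟩
      a * (a * a ℤ.^ N) - a         ≡⟨ factor a (a ℤ.^ N) ⟩
      a * (a ℤ.^ N * a - 1ℤ)        ∎

  unit-inverse : ∀ t → ∃ λ u → + unit u * + unit t ≡ 1ℤ [mod p ]
  -- Here `N` is `p - 2`, so the power `N` of a unit is its inverse.
  unit-inverse t = let u , eq = residue (unit t ℕ.^ N) (∤unit t ∘ prime∣^⇒∣ prime-p (unit t) N) in
    u , mod-trans p {+ unit u * + unit t} {(+ unit t) ℤ.^ N * + unit t} {1ℤ}
    (mod-* p {+ unit u} {(+ unit t) ℤ.^ N} {+ unit t} {+ unit t}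
      (≡.subst (+ unit u ≡_[mod p ]) (pos-^ (unit t) N) (mod-sym p eq)) (refl-mod p (+ unit t)))
    (fermat-inverse (+ unit t) (fermat prime-p (unit t)) (∤unit t ∘ ∣⇒∣ᵤ))

  unit-/ : ∀ s t → ∃ λ u → + unit u * + unit t ≡ + unit s [mod p ]
  unit-/ s t =
    let i , it≡1 = unit-inverse t
        u , si≡u = unit-* s i
    in u , quotient {+ unit u} {+ unit s} {+ unit i} {+ unit t} (mod-sym p si≡u) it≡1
    where
    quotient : ∀ {a b c d} → a ≡ b * c [mod p ] → c * d ≡ 1ℤ [mod p ] → a * d ≡ b [mod p ]
    quotient {a} {b} {c} {d} a≡bc cd≡1 = begin
      a * d          ≈⟨ mod-* p {a} {b * c} {d} {d} a≡bc (refl-mod p d) ⟩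
      b * c * d      ≡⟨ ℤₚ.*-assoc b c d ⟩
      b * (c * d)    ≈⟨ mod-* p {b} {b} {c * d} {1ℤ} (refl-mod p b) cd≡1 ⟩
      b * 1ℤ         ≡⟨ ℤₚ.*-identityʳ b ⟩
      b              ∎
      where open import Relation.Binary.Reasoning.Setoid (CommutativeSemiring.setoid (ℤ/n p))

  -- Congruent to unit t modulo p and to 1 modulo 8.
  abstract
    base : Fin (suc N) → ℕ
    base t = unit t ℕ.+ suc (7 ℕ.* unit t) ℕ.* p ℕ.* p

    base≡unit : ∀ t → + base t ≡ + unit t [mod p ]
    base≡unit t = +m+n*o≡m (unit t) (suc (7 ℕ.* unit t) ℕ.* p) p

    -- Modulo 8 the factor `p * p` is 1, and the coefficient `1 + 7 * unit t` is chosen so that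
    -- adding `unit t` gives `1 + 8 * unit t`.
    base≡1+8d : ∀ t → base t ≡ 1 ℕ.+ (unit t ℕ.+ suc (7 ℕ.* unit t) ℕ.* j) ℕ.* 8
    base≡1+8d t = ≡.trans
      (≡.cong (unit t ℕ.+_) (≡.trans (ℕₚ.*-assoc (suc (7 ℕ.* unit t)) p p) (≡.cong (suc (7 ℕ.* unit t) ℕ.*_) p²≡1+8j)))
      (regroup (unit t) j)
      where
      regroup : ∀ T j → T ℕ.+ suc (7 ℕ.* T) ℕ.* suc (8 ℕ.* j) ≡ 1 ℕ.+ (T ℕ.+ suc (7 ℕ.* T) ℕ.* j) ℕ.* 8
      regroup = ℕ-Solver.solve-∀

  base≡1 : ∀ t → + base t ≡ 1ℤ [mod 8 ]
  base≡1 t = ≡.subst (λ x → + x ≡ 1ℤ [mod 8 ]) (≡.sym (base≡1+8d t)) (+m+n*o≡m 1 (unit t ℕ.+ suc (7 ℕ.* unit t) ℕ.* j) 8)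

  p∤8 : ¬ (p ℕᵈ.∣ 8)
  p∤8 p∣8 = ¬prime[1] (≡.subst Prime (ℕᵈ.∣1⇒≡1 p∣1) prime-p)
    where
    p∣1 : p ℕᵈ.∣ 1
    p∣1 = ℕᵈ.∣m+n∣m⇒∣n (≡.subst (p ℕᵈ.∣_) (≡.trans p²≡1+8j (ℕₚ.+-comm 1 (8 ℕ.* j))) (ℕᵈ.m∣m*n p)) (ℕᵈ.∣m⇒∣m*n j p∣8)

  combine : ∀ {a b} → a ≡ b [mod 8 ] → a ≡ b [mod p ] → a ≡ b [mod 8 ℕ.* p ]
  combine (congruent x) (congruent y) = congruent (∣ᵤ⇒∣ (coprime-*-∣ (prime∤⇒coprime prime-p p∤8) (∣⇒∣ᵤ x) (∣⇒∣ᵤ y)))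

  -- The Teichmüller representative of `unit t` modulo `p ^ 3`. Two `p`-th powers are taken because
  -- each gains one factor `p`, and the bases are controlled only modulo `8 * p`.
  exponent : Fin (suc N) → ℕ
  exponent t = (base t ℕ.^ p) ℕ.^ p

  v = 8 ℕ.* p ℕ.^ 3

  lift : ∀ {a b} → a ≡ b [mod 8 ℕ.* p ] → (a ℤ.^ p) ℤ.^ p ≡ (b ℤ.^ p) ℤ.^ p [mod v ]
  lift {a} {b} a≡b = ≡.subst (λ n → (a ℤ.^ p) ℤ.^ p ≡ (b ℤ.^ p) ℤ.^ p [mod n ]) (eq p)
    (^p-mod {p} (ℕᵈ.n∣m*n (8 ℕ.* p)) (^p-mod {p} (ℕᵈ.n∣m*n 8) a≡b))
    where
    eq : ∀ p → 8 ℕ.* p ℕ.* p ℕ.* p ≡ 8 ℕ.* (p ℕ.* (p ℕ.* (p ℕ.* 1)))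
    eq = ℕ-Solver.solve-∀

  pos-exponent : ∀ t → + exponent t ≡ ((+ base t) ℤ.^ p) ℤ.^ p
  pos-exponent t = ≡.trans (pos-^ (base t ℕ.^ p) p) (≡.cong (ℤ._^ p) (pos-^ (base t) p))

  ^-distrib-* : ∀ a b n → (a * b) ℤ.^ n ≡ a ℤ.^ n * b ℤ.^ n
  ^-distrib-* a b zero    = ≡.refl
  ^-distrib-* a b (suc n) = ≡.trans (≡.cong (a * b *_) (^-distrib-* a b n)) (regroup a b (a ℤ.^ n) (b ℤ.^ n))
    where
    regroup : ∀ a b x y → a * b * (x * y) ≡ a * x * (b * y)
    regroup = solve-∀

  -- The bases multiply like the units modulo `8 * p`, and `lift` carries this relation to the full
  -- group order.
  exponent-* : ∀ {s t u} → + unit s * + unit t ≡ + unit u [mod p ] → + (exponent s ℕ.* exponent t) ≡ + exponent u [mod v ]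
  exponent-* {s} {t} {u} st≡u = ≡.subst₂ (_≡_[mod v ]) (≡.sym eq) (≡.sym (pos-exponent u))
    (lift {+ base s * + base t} {+ base u} (combine mod8 modp))
    where
    mod8 : + base s * + base t ≡ + base u [mod 8 ]
    mod8 = mod-trans 8 {+ base s * + base t} {1ℤ} {+ base u}
      (mod-* 8 {+ base s} {1ℤ} {+ base t} {1ℤ} (base≡1 s) (base≡1 t)) (mod-sym 8 (base≡1 u))
    modp : + base s * + base t ≡ + base u [mod p ]
    modp = mod-trans p {+ base s * + base t} {+ unit s * + unit t} {+ base u}
      (mod-* p {+ base s} {+ unit s} {+ base t} {+ unit t} (base≡unit s) (base≡unit t))
      (mod-trans p {+ unit s * + unit t} {+ unit u} {+ base u} st≡u (mod-sym p (base≡unit u)))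
    open ≡.≡-Reasoning
    eq : + (exponent s ℕ.* exponent t) ≡ ((+ base s * + base t) ℤ.^ p) ℤ.^ p
    eq = begin
      + (exponent s ℕ.* exponent t)                                  ≡⟨ ℤₚ.pos-* (exponent s) (exponent t) ⟩
      + exponent s * + exponent t                                    ≡⟨ ≡.cong₂ _*_ (pos-exponent s) (pos-exponent t) ⟩
      ((+ base s) ℤ.^ p) ℤ.^ p * ((+ base t) ℤ.^ p) ℤ.^ p            ≡⟨ ^-distrib-* ((+ base s) ℤ.^ p) ((+ base t) ℤ.^ p) p ⟨
      ((+ base s) ℤ.^ p * (+ base t) ℤ.^ p) ℤ.^ p                    ≡⟨ ≡.cong (ℤ._^ p) (^-distrib-* (+ base s) (+ base t) p) ⟨
      ((+ base s * + base t) ℤ.^ p) ℤ.^ p                            ∎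

  exponent-zero : + exponent zero ≡ 1ℤ [mod v ]
  exponent-zero = ≡.subst₂ (_≡_[mod v ]) (≡.sym (pos-exponent zero)) (≡.trans (≡.cong (ℤ._^ p) (ℤₚ.^-zeroˡ p)) (ℤₚ.^-zeroˡ p))
    (lift (combine (base≡1 zero) (≡.subst (λ n → + base zero ≡ + n [mod p ]) unit-zero (base≡unit zero))))

  -- Fermat's little theorem, used twice, removes both `p`-th powers. Distinct exponents therefore
  -- stay distinct modulo `p`, which is the source of freeness.
  exponent≡unit : ∀ t → + exponent t ≡ + unit t [mod p ]
  exponent≡unit t = mod-trans p (≡.subst (_≡ + (base t ℕ.^ p) [mod p ]) (≡.sym (pos-^ (base t ℕ.^ p) p)) (fermat prime-p (base t ℕ.^ p)))
    (mod-trans p (≡.subst (_≡ + base t [mod p ]) (≡.sym (pos-^ (base t) p)) (fermat prime-p (base t))) (base≡unit t))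

coprime-^ : ∀ {m n} k → Coprime m n → Coprime (m ℕ.^ k) n
coprime-^ zero    _       (d∣1 , _)   = ℕᵈ.∣1⇒≡1 d∣1
coprime-^ (suc k) coprime (d∣ , d∣n) = coprime-^ k coprime
  (coprime-divisor (λ (c∣d , c∣m) → coprime (c∣m , ℕᵈ.∣-trans c∣d d∣n)) d∣ , d∣n)

-- Fibre sums modulo `p - 1`.

module FibreCongruence {p N j j′ : ℕ} (prime-p : Prime p) (p≡2+N : p ≡ 2 ℕ.+ N) (p²≡1+8j : p ℕ.* p ≡ suc (8 ℕ.* j))
  (p⁶≡1+8j′ : p ℕ.^ 3 ℕ.* p ℕ.^ 3 ≡ suc (8 ℕ.* j′)) (G : FiniteAbelianGroup (8 ℕ.* p ℕ.^ 3))
  (E : Fin (8 ℕ.* p ℕ.^ 3) → ℤ) (trit : ∀ g → Trit (E g)) (c : ℤ)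
  (square : SquaresTo G E (+ (2 ℕ.* p) * + (2 ℕ.* p)) c) where

  private
    v = 8 ℕ.* p ℕ.^ 3
    k = p ℕ.^ 3 ℕ.* p ℕ.^ 3

  open Over v
  open GroupPowers G
  open Powers G
  open Teichmüller {p} {N} {j} prime-p p≡2+N p²≡1+8j hiding (v)
  open Projection G {8} {p ℕ.^ 3} {k} {p ℕ.^ 3} {j′} ≡.refl ≡.refl p⁶≡1+8j′

  2∤base : ∀ t → ¬ (2 ℕᵈ.∣ base t)
  2∤base t 2∣base = contradiction (ℕᵈ.∣1⇒≡1 2∣1) λ ()
    where
    d = unit t ℕ.+ suc (7 ℕ.* unit t) ℕ.* j
    2∣1 : 2 ℕᵈ.∣ 1
    2∣1 = ℕᵈ.∣m+n∣m⇒∣n (≡.subst (2 ℕᵈ.∣_) (≡.trans (base≡1+8d t) (ℕₚ.+-comm 1 (d ℕ.* 8))) 2∣base)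
      (ℕᵈ.∣n⇒∣m*n d (ℕᵈ.divides 4 ≡.refl))

  p∤base : ∀ t → ¬ (p ℕᵈ.∣ base t)
  p∤base t p∣base = ∤unit t (∣⇒∣ᵤ (ModN.≡0⇒∣ p (ModN.mod-trans p (ModN.mod-sym p (base≡unit t)) (ModN.∣⇒≡0 p (∣ᵤ⇒∣ p∣base)))))

  E-base : ∀ t g → E (g ^ base t) ≡ E g
  E-base t = multiplier G E trit (2 ℕ.* p) c square (base t) {{base≢0}} good
    where
    base≢0 : NonZero (base t)
    base≢0 = ≡.subst NonZero (≡.sym (base≡1+8d t)) _
    good : ∀ {q} → Prime q → q ℕᵈ.∣ base t → ¬ (2 ℕᵈ.∣ q) × ¬ (q ℕᵈ.∣ v) × ¬ (q ℕᵈ.∣ 2 ℕ.* p)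
    good {q} prime-q q∣base = (λ 2∣q → 2∤base t (ℕᵈ.∣-trans 2∣q q∣base))
      , (λ q∣v → [ q∤2 ∘ prime∣^⇒∣ prime-q 2 3 , q∤p ∘ prime∣^⇒∣ prime-q p 3 ]′ (euclidsLemma 8 (p ℕ.^ 3) prime-q q∣v))
      , (λ q∣2p → [ q∤2 , q∤p ]′ (euclidsLemma 2 p prime-q q∣2p))
      where
      q∤2 : ¬ (q ℕᵈ.∣ 2)
      q∤2 q∣2 = 2∤base t (≡.subst (ℕᵈ._∣ base t) (prime∣prime⇒≡ prime-q prime[2] q∣2) q∣base)
      q∤p : ¬ (q ℕᵈ.∣ p)
      q∤p q∣p = p∤base t (≡.subst (ℕᵈ._∣ base t) (prime∣prime⇒≡ prime-q prime-p q∣p) q∣base)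

  E-^ : ∀ b → (∀ g → E (g ^ b) ≡ E g) → ∀ n g → E (g ^ (b ℕ.^ n)) ≡ E g
  E-^ b E-b zero    g = ≡.cong E (identityʳ g)
  E-^ b E-b (suc n) g = ≡.trans (≡.cong E (^-* g b (b ℕ.^ n))) (≡.trans (E-^ b E-b n (g ^ b)) (E-b g))

  E-exponent : ∀ t g → E (g ^ exponent t) ≡ E g
  E-exponent t = E-^ (base t ℕ.^ p) (E-^ (base t) (E-base t) p) p

  fixed-^ : ∀ {a} b → a ^ b ≡ a → ∀ n → a ^ (b ℕ.^ n) ≡ a
  fixed-^ b a^b zero    = identityʳ _
  fixed-^ {a} b a^b (suc n) = ≡.trans (^-* a b (b ℕ.^ n)) (≡.trans (≡.cong (_^ (b ℕ.^ n)) a^b) (fixed-^ b a^b n))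

  fixed-exponent : ∀ t {a} → a ^ 8 ≡ ε → a ^ exponent t ≡ a
  fixed-exponent t {a} a^8 = fixed-^ (base t ℕ.^ p) (fixed-^ (base t) a^base p) p
    where
    d = unit t ℕ.+ suc (7 ℕ.* unit t) ℕ.* j
    a^base : a ^ base t ≡ a
    a^base = ≡.trans (≡.cong (a ^_) (base≡1+8d t))
      (≡.trans (≡.cong (a ∙_) (^-∣ {a} {8} (ℕᵈ.n∣m*n d) a^8)) (identityʳ a))

  exponent-∘ : ∀ {s t u} → + unit s * + unit t ≡ + unit u [mod p ] → ∀ g → (g ^ exponent s) ^ exponent t ≡ g ^ exponent u
  exponent-∘ {s} {t} {u} st≡u g = ≡.trans (≡.sym (^-* g (exponent s) (exponent t))) (^-mod G g (exponent-* {s} {t} {u} st≡u))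

  exponent-inverse : ∀ {s t} → + unit s * + unit t ≡ 1ℤ [mod p ] → ∀ g → (g ^ exponent s) ^ exponent t ≡ g
  exponent-inverse {s} {t} st≡1 g = ≡.trans
    (exponent-∘ {s} {t} {zero} (≡.subst (λ n → + unit s * + unit t ≡ + n [mod p ]) (≡.sym unit-zero) st≡1) g)
    (≡.trans (^-mod G g {exponent zero} {1} exponent-zero) (identityʳ g))

  π : Fin (suc N) → Permutation v v
  π t = let u , ut≡1 = unit-inverse t in
    permutation (_^ exponent t) (_^ exponent u) (exponent-inverse {u} {t} ut≡1)
      (λ g → ≡.trans (^-swap g (exponent t) (exponent u)) (exponent-inverse {u} {t} ut≡1 g))

  π-injective : ∀ t {g h} → g ^ exponent t ≡ h ^ exponent t → g ≡ h
  π-injective t {g} {h} eq = let u , ut≡1 = unit-inverse t in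
    ≡.trans (≡.sym (back u ut≡1 g)) (≡.trans (≡.cong (_^ exponent u) eq) (back u ut≡1 h))
    where
    back : ∀ u → + unit u * + unit t ≡ 1ℤ [mod p ] → ∀ g → (g ^ exponent t) ^ exponent u ≡ g
    back u ut≡1 g = ≡.trans (^-swap g (exponent t) (exponent u)) (exponent-inverse {u} {t} ut≡1 g)

  closed : ∀ s t → ∃ λ u → ∀ g → (g ^ exponent t) ^ exponent s ≡ g ^ exponent u
  closed s t = let u , ts≡u = unit-* t s in u , exponent-∘ {t} {s} {u} ts≡u

  transitive : ∀ s t → ∃ λ u → ∀ g → (g ^ exponent t) ^ exponent u ≡ g ^ exponent s
  transitive s t = let u , ut≡s = unit-/ s t in
    u , λ g → ≡.trans (^-swap g (exponent t) (exponent u)) (exponent-∘ {u} {t} {s} ut≡s g)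

  fibreSum-mod : ∀ {a} → a ^ 8 ≡ ε → fibreSum E a ≡ E a [mod suc N ]
  fibreSum-mod {a} a^8 = congruent (≡.subst (+ suc N ∣_) ∑w≡ order∣∑)
    where
    -- The point `a` is removed from its fibre because every exponent fixes it; it accounts for the
    -- term `E a` of the congruence.
    punctured? : ∀ g → Dec (g ^ k ≡ a × ¬ (g ≡ a))
    punctured? g = (g ^ k ≟ a) ×-dec ¬? (g ≟ a)
    w : Fin v → ℤ
    w g = ⟦ punctured? g ⟧ * E g
    invariant : ∀ t g → w (g ^ exponent t) ≡ w g
    invariant t g = ≡.cong₂ _*_ (⟦⟧-cong (punctured? (g ^ exponent t)) (punctured? g)
      (λ (in-fibre , g^≢a) → ≡.trans (≡.sym same) in-fibre , λ g≡a → g^≢a (≡.trans (≡.cong (_^ exponent t) g≡a) (fixed-exponent t a^8)))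
      (λ (in-fibre , g≢a) → ≡.trans same in-fibre , λ g^≡a → g≢a (π-injective t (≡.trans g^≡a (≡.sym (fixed-exponent t a^8))))))
      (E-exponent t g)
      where
      -- The projection `g ^ k` is 8-torsion and the exponents are 1 modulo 8, so these powers of
      -- `g` stay in its fibre.
      same : (g ^ exponent t) ^ k ≡ g ^ k
      same = ≡.trans (^-swap g (exponent t) k) (fixed-exponent t (^k-torsion g))
    separated : ∀ {s t d} → ¬ (s ≡ t) → + d ≡ + exponent s - + exponent t → ¬ (p ℕᵈ.∣ d)
    separated {s} {t} s≢t d≡ p∣d = s≢t (unit-injective
      (ModN.mod-trans p (ModN.mod-sym p (exponent≡unit s))
        (ModN.mod-trans p {+ exponent s} {+ exponent t} (congruent (≡.subst (+ p ∣_) d≡ (∣ᵤ⇒∣ p∣d))) (exponent≡unit t))))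
    -- If distinct exponents agree at `g`, then `g ^ d ≡ ε` for some `d` prime to `p`. Since the
    -- order of `g` also divides `8 * p ^ 3`, `g` is 8-torsion. The projection then fixes `g`, yet
    -- it sends `g` to `a`.
    free′ : ∀ {g} → g ^ k ≡ a → ¬ (g ≡ a) → ∀ {s t} → g ^ exponent s ≡ g ^ exponent t → s ≡ t
    free′ {g} g^k g≢a {s} {t} eq with s ≟ t
    ... | yes s≡t = s≡t
    ... | no  s≢t = contradiction (≡.trans (≡.sym (^k-fixes g^8)) g^k) g≢a
      where
      difference = ^-≡⇒difference G g (exponent s) (exponent t) eq
      d = proj₁ difference
      g^d = proj₁ (proj₂ difference)
      p∤d : ¬ (p ℕᵈ.∣ d)
      p∤d = [ separated {s} {t} s≢t , separated {t} {s} (s≢t ∘ ≡.sym) ]′ (proj₂ (proj₂ difference))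
      g^8 : g ^ 8 ≡ ε
      g^8 = coprime-torsion (coprime-^ 3 (prime∤⇒coprime prime-p p∤d))
        (≡.trans (≡.sym (^-* g 8 (p ℕ.^ 3))) (lagrange g))
        (≡.trans (^-swap g 8 d) (≡.trans (≡.cong (_^ 8) g^d) (ε^ 8)))
    free : ∀ {g} → ¬ (w g ≡ 0ℤ) → ∀ {s t} → g ^ exponent s ≡ g ^ exponent t → s ≡ t
    free {g} w≢0 = by-cases (punctured? g) ≡.refl
      where
      by-cases : (d : Dec (g ^ k ≡ a × ¬ (g ≡ a))) → ⟦ d ⟧ ≡ ⟦ punctured? g ⟧ → ∀ {s t} → g ^ exponent s ≡ g ^ exponent t → s ≡ t
      by-cases (yes (g^k , g≢a)) _  = free′ g^k g≢a
      by-cases (no _)            eq = contradiction (≡.trans (≡.cong (_* E g) (≡.sym eq)) (ℤₚ.*-zeroˡ (E g))) w≢0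
    open FreeAction π closed transitive w invariant free
    split : ∀ g → ⟦ g ^ k ≟ a ⟧ * E g ≡ w g + ⟦ a ≟ g ⟧ * E g
    split g = ≡.trans (≡.cong (_* E g) (indicators g)) (ℤₚ.*-distribʳ-+ (E g) ⟦ punctured? g ⟧ ⟦ a ≟ g ⟧)
      where
      indicators : ∀ g → ⟦ g ^ k ≟ a ⟧ ≡ ⟦ punctured? g ⟧ + ⟦ a ≟ g ⟧
      indicators g with a ≟ g
      ... | yes ≡.refl = ≡.trans (⟦⟧-true (a ^ k ≟ a) (^k-fixes a^8))
            (≡.cong (_+ 1ℤ) (≡.sym (⟦⟧-false (punctured? a) (λ (_ , a≢a) → a≢a ≡.refl))))
      ... | no a≢g = ≡.trans (⟦⟧-cong (g ^ k ≟ a) (punctured? g) (λ g^k → g^k , a≢g ∘ ≡.sym) proj₁)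
            (≡.sym (ℤₚ.+-identityʳ ⟦ punctured? g ⟧))
    open ≡.≡-Reasoning
    cancel : ∀ x y → x ≡ (x + y) - y
    cancel = solve-∀
    ∑w≡ : ∑ w ≡ fibreSum E a - E a
    ∑w≡ = begin
      ∑ w                                                  ≡⟨ cancel (∑ w) (E a) ⟩
      (∑ w + E a) - E a                                    ≡⟨ ≡.cong (λ x → (∑ w + x) - E a) (∑-⟦⟧ a E) ⟨
      (∑ w + ∑ (λ g → ⟦ a ≟ g ⟧ * E g)) - E a              ≡⟨ ≡.cong (_- E a) (∑-+ w (λ g → ⟦ a ≟ g ⟧ * E g)) ⟨
      ∑ (λ g → w g + ⟦ a ≟ g ⟧ * E g) - E a                ≡⟨ ≡.cong (_- E a) (∑-cong split) ⟨
      fibreSum E a - E a                                   ∎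

-- From the difference set to the square of `E`.

∑-∈? : ∀ {n} (D : Subset n) → Over.∑ n (λ i → ⟦ i ∈? D ⟧) ≡ + Subset.∣ D ∣
∑-∈? []            = ≡.refl
∑-∈? (inside  ∷ D) = ≡.cong (_+_ 1ℤ) (∑-∈? D)
∑-∈? (outside ∷ D) = ≡.trans (ℤₚ.+-identityˡ _) (∑-∈? D)

module _ {a} {A : Set a} {P : A → Set} (P? : Decidable P) where

  count-tabulate : ∀ {n} (f : Fin n → A) → + length (filter P? (tabulate f)) ≡ Over.∑ n (λ i → ⟦ P? (f i) ⟧)
  count-tabulate {zero}  f = ≡.refl
  count-tabulate {suc n} f with P? (f zero)
  ... | yes _ = ≡.cong (_+_ 1ℤ) (count-tabulate (f ∘ suc))
  ... | no  _ = ≡.trans (count-tabulate (f ∘ suc)) (≡.sym (ℤₚ.+-identityˡ _))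

module _ {n : ℕ} {P : Fin n × Fin n → Set} (P? : Decidable P) where

  count-pairs : + length (filter P? (cartesianProduct (allFin n) (allFin n))) ≡ Over.∑ n (λ i → Over.∑ n (λ j → ⟦ P? (i , j) ⟧))
  count-pairs = go (λ i → i)
    where
    go : ∀ {m} (f : Fin m → Fin n) →
      + length (filter P? (cartesianProduct (tabulate f) (allFin n))) ≡ Over.∑ m (λ i → Over.∑ n (λ j → ⟦ P? (f i , j) ⟧))
    go {zero}  f = ≡.refl
    go {suc m} f = begin
      + length (filter P? (row ++ rest))                           ≡⟨ ≡.cong (λ xs → + length xs) (filter-++ P? row rest) ⟩
      + length (filter P? row ++ filter P? rest)                   ≡⟨ ≡.cong +_ (length-++ (filter P? row)) ⟩
      + length (filter P? row) + + length (filter P? rest)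
        ≡⟨ ≡.cong₂ _+_ (≡.trans (≡.cong (λ xs → + length (filter P? xs)) (map-tabulate (λ j → j) (f zero ,_)))
             (count-tabulate P? (f zero ,_))) (go (f ∘ suc)) ⟩
      Over.∑ (suc m) (λ i → Over.∑ n (λ j → ⟦ P? (f i , j) ⟧))    ∎
      where
      open ≡.≡-Reasoning
      row = map (f zero ,_) (allFin n)
      rest = cartesianProduct (tabulate (f ∘ suc)) (allFin n)

-- The first count is written `2 + μ` because the difference 2 is what cancels the multiple of D in
-- the square of D - 1.
module RegularPDS {v : ℕ} (G : FiniteAbelianGroup v) (D : Subset v) {k μ : ℕ} (pds : IsRegularPDS G D k (2 ℕ.+ μ) μ) where
  open IsRegularPDS pds
  open IsPDS isPDS
  open GroupPowers G
  open Powers G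
  open Over v

  d δ E : Fin v → ℤ
  d g = ⟦ g ∈? D ⟧
  δ g = ⟦ ε ≟ g ⟧
  E g = d g - δ g

  d-ε : d ε ≡ 0ℤ
  d-ε = ⟦⟧-false (ε ∈? D) identityNotIn

  d-sym : ∀ g → d (g ⁻¹) ≡ d g
  d-sym g = ⟦⟧-cong (g ⁻¹ ∈? D) (g ∈? D)
    (λ g⁻¹∈D → ≡.subst (_∈ D) (⁻¹-involutive g) (inverseClosed (g ⁻¹) g⁻¹∈D)) (inverseClosed g)

  δ-sym : ∀ g → δ (g ⁻¹) ≡ δ g
  δ-sym g = ⟦⟧-cong (ε ≟ g ⁻¹) (ε ≟ g)
    (λ ε≡g⁻¹ → ≡.trans (≡.sym ε⁻¹≈ε) (≡.trans (≡.cong _⁻¹ ε≡g⁻¹) (⁻¹-involutive g)))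
    (λ ε≡g → ≡.trans (≡.sym ε⁻¹≈ε) (≡.cong _⁻¹ ε≡g))

  E-sym : ∀ g → E (g ⁻¹) ≡ E g
  E-sym g = ≡.cong₂ _-_ (d-sym g) (δ-sym g)

  E-ε : E ε ≡ -1ℤ
  E-ε = ≡.cong₂ _-_ d-ε (⟦⟧-true (ε ≟ ε) ≡.refl)

  E-trit : ∀ g → Trit (E g)
  E-trit g = go (ε ≟ g) (g ∈? D)
    where
    go : Dec (ε ≡ g) → Dec (g ∈ D) → Trit (E g)
    go (yes ≡.refl) _         = ≡.subst Trit (≡.sym E-ε) neg
    go (no ε≢g)     (yes g∈D) = ≡.subst Trit (≡.sym (≡.cong₂ _-_ (⟦⟧-true (g ∈? D) g∈D) (⟦⟧-false (ε ≟ g) ε≢g))) pos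
    go (no ε≢g)     (no g∉D)  = ≡.subst Trit (≡.sym (≡.cong₂ _-_ (⟦⟧-false (g ∈? D) g∉D) (⟦⟧-false (ε ≟ g) ε≢g))) none

  E≢-1 : ∀ {g} → ¬ (ε ≡ g) → ¬ (E g ≡ -1ℤ)
  E≢-1 {g} ε≢g = go (g ∈? D)
    where
    go : Dec (g ∈ D) → ¬ (E g ≡ -1ℤ)
    go (yes g∈D) eq = contradiction (≡.trans (≡.sym (≡.cong₂ _-_ (⟦⟧-true (g ∈? D) g∈D) (⟦⟧-false (ε ≟ g) ε≢g))) eq) λ ()
    go (no g∉D)  eq = contradiction (≡.trans (≡.sym (≡.cong₂ _-_ (⟦⟧-false (g ∈? D) g∉D) (⟦⟧-false (ε ≟ g) ε≢g))) eq) λ ()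

  ∑E : ∑ E ≡ + k - 1ℤ
  ∑E = begin
    ∑ (λ g → d g - δ g)                ≡⟨ ∑-cong (λ g → minus (d g) (δ g)) ⟩
    ∑ (λ g → d g + δ g * -1ℤ)          ≡⟨ ∑-+ d (λ g → δ g * -1ℤ) ⟩
    ∑ d + ∑ (λ g → δ g * -1ℤ)          ≡⟨ ≡.cong₂ _+_ (≡.trans (∑-∈? D) (≡.cong +_ size)) (∑-⟦⟧ ε (λ _ → -1ℤ)) ⟩
    + k - 1ℤ                           ∎
    where
    open ≡.≡-Reasoning
    minus : ∀ x y → x - y ≡ x + y * -1ℤ
    minus = solve-∀

  -- For given `g` the only possible partner is `(g ⁻¹ ∙ x) ⁻¹`, so the inner count reduces to one
  -- term, and symmetry of `D` removes the outer inverse. The condition that the partners differ is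
  -- automatic when `x` is not the identity.
  d⋆d≡repCount : ∀ x → ¬ (x ≡ ε) → ∑ (λ a → d a * d (a ⁻¹ ∙ x)) ≡ + repCount G D x
  d⋆d≡repCount x x≢ε = ≡.sym (≡.trans (count-pairs {v} {Rep G D x} _) (∑-cong row))
    where
    open ≡.≡-Reasoning
    solution : ∀ g h → g ∙ h ⁻¹ ≡ x → (g ⁻¹ ∙ x) ⁻¹ ≡ h
    solution g h eq = begin
      (g ⁻¹ ∙ x) ⁻¹              ≡⟨ ≡.cong (λ y → (g ⁻¹ ∙ y) ⁻¹) eq ⟨
      (g ⁻¹ ∙ (g ∙ h ⁻¹)) ⁻¹     ≡⟨ ≡.cong _⁻¹ (\\-leftDividesʳ g (h ⁻¹)) ⟩
      h ⁻¹ ⁻¹                    ≡⟨ ⁻¹-involutive h ⟩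
      h                          ∎
    solution⁻¹ : ∀ g h → (g ⁻¹ ∙ x) ⁻¹ ≡ h → g ∙ h ⁻¹ ≡ x
    solution⁻¹ g h eq = begin
      g ∙ h ⁻¹                   ≡⟨ ≡.cong (λ y → g ∙ y ⁻¹) eq ⟨
      g ∙ ((g ⁻¹ ∙ x) ⁻¹) ⁻¹     ≡⟨ ≡.cong (g ∙_) (⁻¹-involutive _) ⟩
      g ∙ (g ⁻¹ ∙ x)             ≡⟨ \\-leftDividesˡ g x ⟩
      x                          ∎
    entry : ∀ g h → ⟦ (g ∈? D) ×-dec ((h ∈? D) ×-dec (¬? (g ≟ h) ×-dec (g ∙ h ⁻¹ ≟ x))) ⟧ ≡ ⟦ (g ⁻¹ ∙ x) ⁻¹ ≟ h ⟧ * (d g * d h)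
    entry g h = go ((g ⁻¹ ∙ x) ⁻¹ ≟ h) (g ∈? D) (h ∈? D)
      where
      rep? = (g ∈? D) ×-dec ((h ∈? D) ×-dec (¬? (g ≟ h) ×-dec (g ∙ h ⁻¹ ≟ x)))
      go : (p : Dec ((g ⁻¹ ∙ x) ⁻¹ ≡ h)) (q : Dec (g ∈ D)) (r : Dec (h ∈ D)) → ⟦ rep? ⟧ ≡ ⟦ p ⟧ * (⟦ q ⟧ * ⟦ r ⟧)
      go (no ¬p) q r = ≡.trans (⟦⟧-false rep? (λ (_ , _ , _ , eq) → ¬p (solution g h eq))) (≡.sym (ℤₚ.*-zeroˡ (⟦ q ⟧ * ⟦ r ⟧)))
      go (yes p) (no ¬q) r = ≡.trans (⟦⟧-false rep? (λ (q , _) → ¬q q)) (≡.sym (≡.cong (1ℤ *_) (ℤₚ.*-zeroˡ ⟦ r ⟧)))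
      go (yes p) (yes q) (no ¬r) = ⟦⟧-false rep? (λ (_ , r , _) → ¬r r)
      go (yes p) (yes q) (yes r) = ⟦⟧-true rep? (q , r , distinct , solution⁻¹ g h p)
        where
        distinct : ¬ (g ≡ h)
        distinct ≡.refl = x≢ε (≡.trans (≡.sym (solution⁻¹ g g p)) (inverseʳ g))
    row : ∀ g → ∑ (λ h → ⟦ (g ∈? D) ×-dec ((h ∈? D) ×-dec (¬? (g ≟ h) ×-dec (g ∙ h ⁻¹ ≟ x))) ⟧) ≡ d g * d (g ⁻¹ ∙ x)
    row g = begin
      ∑ (λ h → ⟦ (g ∈? D) ×-dec ((h ∈? D) ×-dec (¬? (g ≟ h) ×-dec (g ∙ h ⁻¹ ≟ x))) ⟧)   ≡⟨ ∑-cong (entry g) ⟩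
      ∑ (λ h → ⟦ (g ⁻¹ ∙ x) ⁻¹ ≟ h ⟧ * (d g * d h))                      ≡⟨ ∑-⟦⟧ ((g ⁻¹ ∙ x) ⁻¹) (λ h → d g * d h) ⟩
      d g * d ((g ⁻¹ ∙ x) ⁻¹)                                            ≡⟨ ≡.cong (d g *_) (d-sym (g ⁻¹ ∙ x)) ⟩
      d g * d (g ⁻¹ ∙ x)                                                 ∎

  d⋆d-ε : ∑ (λ a → d a * d (a ⁻¹ ∙ ε)) ≡ + k
  d⋆d-ε = ≡.trans (∑-cong (λ a → ≡.trans (≡.cong (λ b → d a * d b) (identityʳ (a ⁻¹)))
    (≡.trans (≡.cong (d a *_) (d-sym a)) (idem (a ∈? D))))) (≡.trans (∑-∈? D) (≡.cong +_ size))
    where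
    idem : ∀ {P : Set} (p : Dec P) → ⟦ p ⟧ * ⟦ p ⟧ ≡ ⟦ p ⟧
    idem (yes _) = ≡.refl
    idem (no _)  = ≡.refl

  E⋆E≡ : ∀ x → ∑ (λ a → E a * E (a ⁻¹ ∙ x)) ≡ ∑ (λ a → d a * d (a ⁻¹ ∙ x)) - d x - d x + δ x
  E⋆E≡ x = begin
    ∑ (λ a → (d a - δ a) * (d (a ⁻¹ ∙ x) - δ (a ⁻¹ ∙ x)))
      ≡⟨ ∑-cong (λ a → ≡.trans (≡.cong (λ y → (d a - δ a) * (d (a ⁻¹ ∙ x) - y)) (δ-shift a))
           (expand (d a) (δ a) (d (a ⁻¹ ∙ x)) ⟦ x ≟ a ⟧)) ⟩
    ∑ (λ a → d a * d (a ⁻¹ ∙ x) + (δ a * - d (a ⁻¹ ∙ x) + ⟦ x ≟ a ⟧ * (δ a - d a)))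
      ≡⟨ ∑-+ (λ a → d a * d (a ⁻¹ ∙ x)) (λ a → δ a * - d (a ⁻¹ ∙ x) + ⟦ x ≟ a ⟧ * (δ a - d a)) ⟩
    S + ∑ (λ a → δ a * - d (a ⁻¹ ∙ x) + ⟦ x ≟ a ⟧ * (δ a - d a))
      ≡⟨ ≡.cong (_+_ S) (∑-+ (λ a → δ a * - d (a ⁻¹ ∙ x)) (λ a → ⟦ x ≟ a ⟧ * (δ a - d a))) ⟩
    S + (∑ (λ a → δ a * - d (a ⁻¹ ∙ x)) + ∑ (λ a → ⟦ x ≟ a ⟧ * (δ a - d a)))
      ≡⟨ ≡.cong (_+_ S) (≡.cong₂ _+_ (∑-⟦⟧ ε (λ a → - d (a ⁻¹ ∙ x))) (∑-⟦⟧ x (λ a → δ a - d a))) ⟩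
    S + (- d (ε ⁻¹ ∙ x) + (δ x - d x))
      ≡⟨ ≡.cong (λ y → S + (- d y + (δ x - d x))) (≡.trans (≡.cong (_∙ x) ε⁻¹≈ε) (identityˡ x)) ⟩
    S + (- d x + (δ x - d x))                ≡⟨ regroup S (d x) (δ x) ⟩
    S - d x - d x + δ x                      ∎
    where
    open ≡.≡-Reasoning
    S = ∑ (λ a → d a * d (a ⁻¹ ∙ x))
    δ-shift : ∀ a → δ (a ⁻¹ ∙ x) ≡ ⟦ x ≟ a ⟧
    δ-shift a = ⟦⟧-cong (ε ≟ a ⁻¹ ∙ x) (x ≟ a)
      (λ eq → ≡.trans (≡.sym (\\-leftDividesˡ a x)) (≡.trans (≡.cong (a ∙_) (≡.sym eq)) (identityʳ a)))
      (λ eq → ≡.sym (≡.trans (≡.cong (a ⁻¹ ∙_) eq) (inverseˡ a)))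
    expand : ∀ p q r s → (p - q) * (r - s) ≡ p * r + (q * - r + s * (q - p))
    expand = solve-∀
    regroup : ∀ s d e → s + (- d + (e - d)) ≡ s - d - d + e
    regroup = solve-∀

  -- Off the identity the subtraction of `2 * d x` levels the counts `2 + μ` and `μ`. At the
  -- identity the coefficient is `k + 1`, which is what the hypothesis on `κ` describes.
  square : ∀ κ → + k + 1ℤ ≡ κ + + μ → ∀ x → ∑ (λ a → E a * E (a ⁻¹ ∙ x)) ≡ κ * δ x + + μ
  square κ κ-eq x = ≡.trans (E⋆E≡ x) (go (ε ≟ x) (x ∈? D))
    where
    open ≡.≡-Reasoning
    S = ∑ (λ a → d a * d (a ⁻¹ ∙ x))
    at-ε : ∀ k κ μ → k + 1ℤ ≡ κ + μ → k - 0ℤ - 0ℤ + 1ℤ ≡ κ * 1ℤ + μ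
    at-ε k κ μ eq = ≡.trans (lhs k) (≡.trans eq (rhs κ μ))
      where
      lhs : ∀ k → k - 0ℤ - 0ℤ + 1ℤ ≡ k + 1ℤ
      lhs = solve-∀
      rhs : ∀ κ μ → κ + μ ≡ κ * 1ℤ + μ
      rhs = solve-∀
    in-D : ∀ κ μ → (1ℤ + 1ℤ + μ) - 1ℤ - 1ℤ + 0ℤ ≡ κ * 0ℤ + μ
    in-D = solve-∀
    off-D : ∀ κ μ → μ - 0ℤ - 0ℤ + 0ℤ ≡ κ * 0ℤ + μ
    off-D = solve-∀
    substitute : ∀ {s s′ dx dx′ δx δx′} → s ≡ s′ → dx ≡ dx′ → δx ≡ δx′ →
      s′ - dx′ - dx′ + δx′ ≡ κ * δx′ + + μ → s - dx - dx + δx ≡ κ * δx + + μ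
    substitute ≡.refl ≡.refl ≡.refl eq = eq
    go : Dec (ε ≡ x) → Dec (x ∈ D) → S - d x - d x + δ x ≡ κ * δ x + + μ
    go (yes ≡.refl) _ = substitute d⋆d-ε d-ε (⟦⟧-true (ε ≟ ε) ≡.refl) (at-ε (+ k) κ (+ μ) κ-eq)
    go (no ε≢x) (yes x∈D) = substitute
      (≡.trans (d⋆d≡repCount x (ε≢x ∘ ≡.sym)) (≡.cong +_ (inD x (ε≢x ∘ ≡.sym) x∈D)))
      (⟦⟧-true (x ∈? D) x∈D) (⟦⟧-false (ε ≟ x) ε≢x) (in-D κ (+ μ))
    go (no ε≢x) (no x∉D) = substitute
      (≡.trans (d⋆d≡repCount x (ε≢x ∘ ≡.sym)) (≡.cong +_ (notInD x (ε≢x ∘ ≡.sym) x∉D)))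
      (⟦⟧-false (x ∈? D) x∉D) (⟦⟧-false (ε ≟ x) ε≢x) (off-D κ (+ μ))

-- Inequalities, orders of coprime factors and distance from the mean.

∑-mono : ∀ n {f h : Fin n → ℤ} → (∀ i → f i ℤ.≤ h i) → Over.∑ n f ℤ.≤ Over.∑ n h
∑-mono zero    f≤h = ℤₚ.≤-refl
∑-mono (suc n) f≤h = ℤₚ.+-mono-≤ (f≤h zero) (∑-mono n (f≤h ∘ suc))

square≡∣∣² : ∀ z → z * z ≡ + (ℤ.∣ z ∣ ℕ.* ℤ.∣ z ∣)
square≡∣∣² (+ n)    = ≡.sym (ℤₚ.pos-* n n)
square≡∣∣² -[1+ n ] = ≡.refl

0≤square : ∀ z → 0ℤ ℤ.≤ z * z
0≤square z = ≡.subst (0ℤ ℤ.≤_) (≡.sym (square≡∣∣² z)) (ℤ.+≤+ ℕ.z≤n)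

-- For `P` as membership in A and `Q` as being the identity: a lower bound known on A without its
-- identity can be summed over the whole group, because at the identity nonnegativity suffices.
indicator-bound : ∀ {P Q : Set} (P? : Dec P) (Q? : Dec Q) → (Q → P) → ∀ b s →
  (P → ¬ Q → b ℤ.≤ s) → 0ℤ ℤ.≤ s → b * (⟦ P? ⟧ - ⟦ Q? ⟧) ℤ.≤ ⟦ P? ⟧ * s
indicator-bound (yes p) (yes q) _   b s _   0≤s = ≡.subst₂ ℤ._≤_ (≡.sym (ℤₚ.*-zeroʳ b)) (≡.sym (ℤₚ.*-identityˡ s)) 0≤s
indicator-bound (yes p) (no ¬q) _   b s b≤s _   = ≡.subst₂ ℤ._≤_ (≡.sym (ℤₚ.*-identityʳ b)) (≡.sym (ℤₚ.*-identityˡ s)) (b≤s p ¬q)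
indicator-bound (no ¬p) (yes q) q⇒p b s _   _   = contradiction (q⇒p q) ¬p
indicator-bound (no ¬p) (no ¬q) _   b s _   _   = ℤₚ.≤-reflexive (≡.trans (ℤₚ.*-zeroʳ b) (≡.sym (ℤₚ.*-zeroˡ s)))

∑⟦⟧-nonneg : ∀ n {P : Fin n → Set} (P? : ∀ i → Dec (P i)) → 0ℤ ℤ.≤ Over.∑ n (λ i → ⟦ P? i ⟧)
∑⟦⟧-nonneg n P? = ≡.subst (ℤ._≤ Over.∑ n (λ i → ⟦ P? i ⟧)) (Over.∑-zero n) (∑-mono n (λ i → nonneg (P? i)))
  where
  nonneg : ∀ {P : Set} (p : Dec P) → 0ℤ ℤ.≤ ⟦ p ⟧
  nonneg (yes _) = ℤ.+≤+ ℕ.z≤n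
  nonneg (no _)  = ℤ.+≤+ ℕ.z≤n

coprime-factors-unique : ∀ {a b m n} → Coprime m b → Coprime n a → .{{NonZero m}} → .{{NonZero n}} →
  a ℕ.* b ≡ m ℕ.* n → a ≡ m × b ≡ n
coprime-factors-unique {a} {b} {m} {n} m⊥b n⊥a ab≡mn = ℕᵈ.∣-antisym a∣m m∣a , ℕᵈ.∣-antisym b∣n n∣b
  where
  m∣a : m ℕᵈ.∣ a
  m∣a = coprime-divisor m⊥b (≡.subst (m ℕᵈ.∣_) (≡.trans (≡.sym ab≡mn) (ℕₚ.*-comm a b)) (ℕᵈ.m∣m*n n))
  n∣b : n ℕᵈ.∣ b
  n∣b = coprime-divisor n⊥a (≡.subst (n ℕᵈ.∣_) (≡.sym ab≡mn) (ℕᵈ.n∣m*n m))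
  a∣m : a ℕᵈ.∣ m
  a∣m = ℕᵈ.*-cancelʳ-∣ n (ℕᵈ.∣-trans (ℕᵈ.*-monoʳ-∣ a n∣b) (ℕᵈ.∣-reflexive ab≡mn))
  b∣n : b ℕᵈ.∣ n
  b∣n = ℕᵈ.*-cancelˡ-∣ m (ℕᵈ.∣-trans (ℕᵈ.*-monoˡ-∣ b m∣a) (ℕᵈ.∣-reflexive ab≡mn))

-- With p = 5 + M; the numbers x(a)/p have mean (2p + 1)/4.
module _ (M : ℕ) where
  private
    P = + (5 ℕ.+ M)

    -- The absolute value of 4x - (2p + 1) in a form that is visibly at least 5: `c` depends on the
    -- residue and the side of the mean, and `m` counts further steps of length p - 1.
    excess : ℕ → ℕ → ℤ
    excess c m = + 5 + (+ c + (+ 2 * + M + + 4 * (+ m * (+ 4 + + M))))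

    far : ∀ z c m → z ≡ excess c m ⊎ - z ≡ excess c m → + 25 ℤ.≤ z * z
    far z c m eq = ≡.subst (+ 25 ℤ.≤_) (≡.sym (square≡∣∣² z)) (ℤ.+≤+ (ℕₚ.*-mono-≤ {5} {ℤ.∣ z ∣} {5} 5≤∣z∣ 5≤∣z∣))
      where
      n = c ℕ.+ (2 ℕ.* M ℕ.+ 4 ℕ.* (m ℕ.* (4 ℕ.+ M)))
      excess≡ : excess c m ≡ + (5 ℕ.+ n)
      excess≡ = ≡.cong (λ x → + 5 + (+ c + x)) (≡.cong₂ _+_ (≡.sym (ℤₚ.pos-* 2 M))
        (≡.trans (≡.cong (+ 4 *_) (≡.sym (ℤₚ.pos-* m (4 ℕ.+ M)))) (≡.sym (ℤₚ.pos-* 4 (m ℕ.* (4 ℕ.+ M))))))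
      ∣z∣ : ℤ.∣ z ∣ ≡ 5 ℕ.+ n
      ∣z∣ = [ (λ z≡ → ≡.cong ℤ.∣_∣ (≡.trans z≡ excess≡))
            , (λ -z≡ → ≡.trans (≡.sym (ℤₚ.∣-i∣≡∣i∣ z)) (≡.cong ℤ.∣_∣ (≡.trans -z≡ excess≡))) ]′ eq
      5≤∣z∣ : 5 ℕ.≤ ℤ.∣ z ∣
      5≤∣z∣ = ≡.subst (5 ℕ.≤_) (≡.sym ∣z∣) (ℕₚ.m≤m+n 5 n)

  -- Write `x` as `e + y * (p - 1)`. The nearest values 0, 1, p - 1 and p give -(2p + 1), -(2p - 3),
  -- 2p - 5 and 2p - 1, which are `5 + c + 2 * M` up to sign with `c` equal to 6, 2, 0 and 4.
  far-from-mean : ∀ {e} → Trit e → ¬ (e ≡ -1ℤ) → ∀ x → x ≡ e [mod 4 ℕ.+ M ] →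
    + 25 ℤ.≤ (+ 4 * x - (+ 2 * P + 1ℤ)) * (+ 4 * x - (+ 2 * P + 1ℤ))
  far-from-mean {e} te e≢-1 x (congruent (divides y eq)) =
    ≡.subst (λ x → + 25 ℤ.≤ (+ 4 * x - (+ 2 * P + 1ℤ)) * (+ 4 * x - (+ 2 * P + 1ℤ)))
      (≡.sym (≡.trans (split x e) (≡.cong (_+_ e) eq))) (go te e≢-1 y)
    where
    split : ∀ x e → x ≡ e + (x - e)
    split = solve-∀
    centred : ℤ → ℤ → ℤ
    centred e y = + 4 * (e + y * + (4 ℕ.+ M)) - (+ 2 * P + 1ℤ)
    above₀ : ∀ m M → + 4 * (0ℤ + (1ℤ + m) * (+ 4 + M)) - (+ 2 * (+ 5 + M) + 1ℤ) ≡ + 5 + (+ 0 + (+ 2 * M + + 4 * (m * (+ 4 + M))))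
    above₀ = solve-∀
    above₁ : ∀ m M → + 4 * (1ℤ + (1ℤ + m) * (+ 4 + M)) - (+ 2 * (+ 5 + M) + 1ℤ) ≡ + 5 + (+ 4 + (+ 2 * M + + 4 * (m * (+ 4 + M))))
    above₁ = solve-∀
    below₀ : ∀ m M → - (+ 4 * (0ℤ + (- m) * (+ 4 + M)) - (+ 2 * (+ 5 + M) + 1ℤ)) ≡ + 5 + (+ 6 + (+ 2 * M + + 4 * (m * (+ 4 + M))))
    below₀ = solve-∀
    below₁ : ∀ m M → - (+ 4 * (1ℤ + (- m) * (+ 4 + M)) - (+ 2 * (+ 5 + M) + 1ℤ)) ≡ + 5 + (+ 2 + (+ 2 * M + + 4 * (m * (+ 4 + M))))
    below₁ = solve-∀
    go : ∀ {e} → Trit e → ¬ (e ≡ -1ℤ) → ∀ y → + 25 ℤ.≤ centred e y * centred e y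
    go neg  e≢-1 y       = contradiction ≡.refl e≢-1
    go none _ (+ suc m)  = far (centred 0ℤ (+ suc m)) 0 m (inj₁ (above₀ (+ m) (+ M)))
    go none _ (+ zero)   = far (centred 0ℤ (+ zero)) 6 0 (inj₂ (below₀ (+ 0) (+ M)))
    go none _ -[1+ m ]   = far (centred 0ℤ -[1+ m ]) 6 (suc m) (inj₂ (below₀ (+ suc m) (+ M)))
    go pos  _ (+ suc m)  = far (centred 1ℤ (+ suc m)) 4 m (inj₁ (above₁ (+ m) (+ M)))
    go pos  _ (+ zero)   = far (centred 1ℤ (+ zero)) 2 0 (inj₂ (below₁ (+ 0) (+ M)))
    go pos  _ -[1+ m ]   = far (centred 1ℤ -[1+ m ]) 2 (suc m) (inj₂ (below₁ (+ suc m) (+ M)))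

-- The second moment of the fibre sums and the contradiction.

module Contradiction {p M j : ℕ} (prime-p : Prime p) (p≡5+M : p ≡ 5 ℕ.+ M) (2∤p : ¬ (2 ℕᵈ.∣ p)) (p²≡1+8j : p ℕ.* p ≡ suc (8 ℕ.* j))
  (G : FiniteAbelianGroup (8 ℕ.* p ℕ.^ 3)) (D : Subset (8 ℕ.* p ℕ.^ 3))
  (pds : IsRegularPDS G D (4 ℕ.* p ℕ.^ 2 ℕ.+ 2 ℕ.* p ℕ.+ 1) (2 ℕ.+ (2 ℕ.* p ℕ.+ 2)) (2 ℕ.* p ℕ.+ 2)) where

  private
    v = 8 ℕ.* p ℕ.^ 3

  open GroupPowers G
  open Powers G
  open Over v
  open RegularPDS G D pds using (E; E-sym; E-trit; ∑E; square)

  -- The eight fibre sums add up to 4p² + 2p, so `w` is four times their mean.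
  P κ c w : ℤ
  P = + p
  κ = + (2 ℕ.* p) * + (2 ℕ.* p)
  c = + (2 ℕ.* p ℕ.+ 2)
  w = P * (+ 2 * P + 1ℤ)

  -- Obtained by expanding `(1 + 8 j) ^ 3` as `1 + 8 j′`.
  j′ = 3 ℕ.* j ℕ.+ 24 ℕ.* (j ℕ.* j) ℕ.+ 64 ℕ.* (j ℕ.* (j ℕ.* j))

  p⁶≡1+8j′ : p ℕ.^ 3 ℕ.* p ℕ.^ 3 ≡ suc (8 ℕ.* j′)
  p⁶≡1+8j′ = ≡.trans (regroup p) (≡.trans (≡.cong (λ n → n ℕ.* (n ℕ.* n)) p²≡1+8j) (expand j))
    where
    regroup : ∀ p → (p ℕ.* (p ℕ.* (p ℕ.* 1))) ℕ.* (p ℕ.* (p ℕ.* (p ℕ.* 1))) ≡ (p ℕ.* p) ℕ.* ((p ℕ.* p) ℕ.* (p ℕ.* p))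
    regroup = ℕ-Solver.solve-∀
    expand : ∀ j → suc (8 ℕ.* j) ℕ.* (suc (8 ℕ.* j) ℕ.* suc (8 ℕ.* j)) ≡
      suc (8 ℕ.* (3 ℕ.* j ℕ.+ 24 ℕ.* (j ℕ.* j) ℕ.+ 64 ℕ.* (j ℕ.* (j ℕ.* j))))
    expand = ℕ-Solver.solve-∀

  open Projection G {8} {p ℕ.^ 3} {p ℕ.^ 3 ℕ.* p ℕ.^ 3} {p ℕ.^ 3} {j′} ≡.refl ≡.refl p⁶≡1+8j′

  pos-2p : + (2 ℕ.* p) ≡ + 2 * P
  pos-2p = ℤₚ.pos-* 2 p

  pos-4p² : + (4 ℕ.* p ℕ.^ 2) ≡ + 4 * (P * P)
  pos-4p² = ≡.trans (ℤₚ.pos-* 4 (p ℕ.^ 2)) (≡.cong (+ 4 *_)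
    (≡.trans (≡.cong (λ n → + (p ℕ.* n)) (ℕₚ.*-identityʳ p)) (ℤₚ.pos-* p p)))

  pos-p³ : + (p ℕ.^ 3) ≡ P * (P * P)
  pos-p³ = ≡.trans (≡.cong (λ n → + (p ℕ.* (p ℕ.* n))) (ℕₚ.*-identityʳ p))
    (≡.trans (ℤₚ.pos-* p (p ℕ.* p)) (≡.cong (P *_) (ℤₚ.pos-* p p)))

  κ≡ : κ ≡ + 4 * (P * P)
  κ≡ = ≡.trans (≡.cong₂ _*_ pos-2p pos-2p) (regroup P)
    where
    regroup : ∀ P → (+ 2 * P) * (+ 2 * P) ≡ + 4 * (P * P)
    regroup = solve-∀

  ∑E≡ : ∑ E ≡ + 4 * (P * P) + + 2 * P
  ∑E≡ = ≡.trans ∑E (≡.trans (≡.cong₂ (λ x y → x + y + 1ℤ - 1ℤ) pos-4p² pos-2p) (cancel (+ 4 * (P * P)) (+ 2 * P)))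
    where
    cancel : ∀ x y → x + y + 1ℤ - 1ℤ ≡ x + y
    cancel = solve-∀

  squareE : SquaresTo G E κ c
  squareE = square κ (≡.trans (≡.cong (λ x → x + + (2 ℕ.* p) + 1ℤ + 1ℤ) (≡.trans pos-4p² (≡.sym κ≡))) (regroup κ (+ (2 ℕ.* p))))
    where
    regroup : ∀ x y → x + y + 1ℤ + 1ℤ ≡ x + (y + + 2)
    regroup = solve-∀

  p∣P* : ∀ x → + p ∣ x * P
  p∣P* x = divides x ≡.refl

  p∣fibreSum : ∀ a → + p ∣ fibreSum E a
  p∣fibreSum = fibreSum-∣ p (p ℕ.^ 2 ℕ.* p ℕ.^ 3) E (ℕₚ.*-assoc p (p ℕ.^ 2) (p ℕ.^ 3))
    (ScalarSquare.fibre-sums G E κ c squareE prime-p E^p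
      (≡.subst (+ p ∣_) (≡.trans (regroup₁ P) (≡.sym κ≡)) (p∣P* (+ 4 * P)))
      (≡.subst (+ p ∣_) (≡.trans (regroup₂ P) (≡.sym ∑E≡)) (p∣P* (+ 4 * P + + 2)))
      (≡.subst (3 ℕ.≤_) (≡.sym p≡5+M) (ℕₚ.m≤m+n 3 (2 ℕ.+ M))))
    where
    regroup₁ : ∀ P → (+ 4 * P) * P ≡ + 4 * (P * P)
    regroup₁ = solve-∀
    regroup₂ : ∀ P → (+ 4 * P + + 2) * P ≡ + 4 * (P * P) + + 2 * P
    regroup₂ = solve-∀
    E^p : ∀ g → E g ℤ.^ p ≡ E g [mod p ]
    E^p g = let m , p≡1+2m = odd⇒suc-double p 2∤p in
      ModN.≡⇒≡[mod] p (≡.trans (≡.cong (E g ℤ.^_) p≡1+2m) (trit-^odd (E-trit g) m))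

  p∤8 : ¬ (p ℕᵈ.∣ 8)
  p∤8 p∣8 = 2∤p (ℕᵈ.∣-reflexive (≡.sym (prime∣prime⇒≡ prime-p prime[2] (prime∣^⇒∣ prime-p 2 3 p∣8))))

  2∤p³ : ¬ (2 ℕᵈ.∣ p ℕ.^ 3)
  2∤p³ = 2∤p ∘ prime∣^⇒∣ prime[2] p 3

  -- The two orders have product `8 * p ^ 3`. By the Cauchy argument the first is prime to `p` and
  -- the second is odd, which leaves one factorisation.
  orders : ℤ.∣ ∣torsion∣ 8 ∣ ≡ 8 × ℤ.∣ ∣torsion∣ (p ℕ.^ 3) ∣ ≡ p ℕ.^ 3
  orders = coprime-factors-unique
    (coprime-^ 3 (prime∤⇒coprime prime[2] (prime∤∣torsion∣ prime[2] (prime∤⇒coprime prime[2] 2∤p³) ∘ ∣ᵤ⇒∣)))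
    (coprime-^ 3 (prime∤⇒coprime prime-p (prime∤∣torsion∣ prime-p (prime∤⇒coprime prime-p p∤8) ∘ ∣ᵤ⇒∣)))
    {{_}} {{ℕₚ.m^n≢0 p 3 {{prime⇒nonZero prime-p}}}}
    (≡.trans (≡.sym (ℤₚ.abs-* (∣torsion∣ 8) (∣torsion∣ (p ℕ.^ 3)))) (≡.cong ℤ.∣_∣ ∣torsion∣-*))

  ∣torsion∣≡ : ∀ {m n} → ℤ.∣ ∣torsion∣ m ∣ ≡ n → ∣torsion∣ m ≡ + n
  ∣torsion∣≡ {m} eq = ≡.trans (≡.sym (ℤₚ.0≤i⇒+∣i∣≡i (∑⟦⟧-nonneg v (λ g → g ^ m ≟ ε)))) (≡.cong +_ eq)

  ∣A∣ : ∣torsion∣ 8 ≡ + 8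
  ∣A∣ = ∣torsion∣≡ {8} (proj₁ orders)

  ∣P∣ : ∣torsion∣ (p ℕ.^ 3) ≡ P * (P * P)
  ∣P∣ = ≡.trans (∣torsion∣≡ {p ℕ.^ 3} (proj₂ orders)) pos-p³

  deviation : Fin v → ℤ
  deviation a = (+ 4 * fibreSum E a - w) * (+ 4 * fibreSum E a - w)

  -- Expanding the square needs only the second moment, the total and the number of fibres. The
  -- terms in p⁴ and p³ cancel, and 64 - 16 + 8 = 56 remains as the coefficient of p².
  total-deviation : ∑ (λ a → torsion 8 a * deviation a) ≡ + 56 * (P * P)
  total-deviation = begin
    ∑ (λ a → torsion 8 a * deviation a)
      ≡⟨ ∑-cong (λ a → ≡.trans (expand (torsion 8 a) (fibreSum E a) w)
           (≡.cong (λ x → + 16 * (x * fibreSum E a) + (- (+ 8 * w) * x + w * w * torsion 8 a)) (fibreSum-support E a))) ⟩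
    ∑ (λ a → + 16 * (fibreSum E a * fibreSum E a) + (- (+ 8 * w) * fibreSum E a + w * w * torsion 8 a))
      ≡⟨ ∑-+ (λ a → + 16 * (fibreSum E a * fibreSum E a)) (λ a → - (+ 8 * w) * fibreSum E a + w * w * torsion 8 a) ⟩
    ∑ (λ a → + 16 * (fibreSum E a * fibreSum E a)) + ∑ (λ a → - (+ 8 * w) * fibreSum E a + w * w * torsion 8 a)
      ≡⟨ ≡.cong₂ _+_ (∑-*ˡ (+ 16) (λ a → fibreSum E a * fibreSum E a))
           (≡.trans (∑-+ (λ a → - (+ 8 * w) * fibreSum E a) (λ a → w * w * torsion 8 a))
             (≡.cong₂ _+_ (∑-*ˡ (- (+ 8 * w)) (fibreSum E)) (∑-*ˡ (w * w) (torsion 8)))) ⟩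
    + 16 * ∑ (λ a → fibreSum E a * fibreSum E a) + (- (+ 8 * w) * ∑ (fibreSum E) + w * w * ∣torsion∣ 8)
      ≡⟨ ≡.cong₂ (λ x y → + 16 * x + y) second-moment (≡.cong₂ (λ x y → - (+ 8 * w) * x + w * w * y) (≡.trans (∑-fibreSum E) ∑E≡) ∣A∣) ⟩
    + 16 * (+ 4 * (P * P) + (+ 2 * P + + 2) * (P * (P * P))) + (- (+ 8 * w) * (+ 4 * (P * P) + + 2 * P) + w * w * + 8)
      ≡⟨ evaluate P ⟩
    + 56 * (P * P) ∎
    where
    open ≡.≡-Reasoning
    second-moment : ∑ (λ a → fibreSum E a * fibreSum E a) ≡ + 4 * (P * P) + (+ 2 * P + + 2) * (P * (P * P))
    second-moment = ≡.trans (∑-fibreSum² E E-sym κ c squareE)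
      (≡.cong₂ _+_ κ≡ (≡.cong₂ _*_ (≡.cong (_+ + 2) pos-2p) ∣P∣))
    expand : ∀ t x w → t * ((+ 4 * x - w) * (+ 4 * x - w)) ≡ + 16 * ((t * x) * x) + (- (+ 8 * w) * (t * x) + w * w * t)
    expand = solve-∀
    evaluate : ∀ P → + 16 * (+ 4 * (P * P) + (+ 2 * P + + 2) * (P * (P * P))) +
      (- (+ 8 * (P * (+ 2 * P + 1ℤ))) * (+ 4 * (P * P) + + 2 * P) + (P * (+ 2 * P + 1ℤ)) * (P * (+ 2 * P + 1ℤ)) * + 8) ≡ + 56 * (P * P)
    evaluate = solve-∀

  fibreSum-deviates : ∀ {a} → a ^ 8 ≡ ε → ¬ (ε ≡ a) → P * P * + 25 ℤ.≤ deviation a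
  fibreSum-deviates {a} a^8 ε≢a = from (p∣fibreSum a)
    where
    n = 4 ℕ.+ M
    X≡E : fibreSum E a ≡ E a [mod n ]
    X≡E = FibreCongruence.fibreSum-mod {p} {3 ℕ.+ M} {j} {j′} prime-p p≡5+M p²≡1+8j p⁶≡1+8j′ G E E-trit c squareE a^8
    E≢-1 : ¬ (E a ≡ -1ℤ)
    E≢-1 = RegularPDS.E≢-1 G D pds ε≢a
    P≡1+n : P ≡ 1ℤ + + n
    P≡1+n = ≡.cong +_ p≡5+M
    from : + p ∣ fibreSum E a → P * P * + 25 ℤ.≤ deviation a
    from (divides x X≡xP) = ≡.subst (P * P * + 25 ℤ.≤_) (≡.sym factored)
      (≡.subst (λ q → q * + 25 ℤ.≤ q * (z * z)) (ℤₚ.pos-* p p) (ℤₚ.*-monoˡ-≤-nonNeg (+ (p ℕ.* p)) 25≤z²))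
      where
      z = + 4 * x - (+ 2 * P + 1ℤ)
      factor : ∀ x P → (+ 4 * (x * P) - P * (+ 2 * P + 1ℤ)) * (+ 4 * (x * P) - P * (+ 2 * P + 1ℤ)) ≡
        P * P * ((+ 4 * x - (+ 2 * P + 1ℤ)) * (+ 4 * x - (+ 2 * P + 1ℤ)))
      factor = solve-∀
      factored : deviation a ≡ P * P * (z * z)
      factored = ≡.trans (≡.cong (λ X → (+ 4 * X - w) * (+ 4 * X - w)) X≡xP) (factor x P)
      difference : ∀ x n → x - x * (1ℤ + n) ≡ - x * n
      difference = solve-∀
      -- Since `p` is 1 modulo `p - 1`, division by `p` does not change the residue.
      x≡X : x ≡ fibreSum E a [mod n ]
      x≡X = congruent (divides (- x) (≡.trans (≡.cong (_-_ x) (≡.trans X≡xP (≡.cong (x *_) P≡1+n))) (difference x (+ n))))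
      25≤z² : + 25 ℤ.≤ z * z
      25≤z² = ≡.subst (λ q → + 25 ℤ.≤ (+ 4 * x - (+ 2 * q + 1ℤ)) * (+ 4 * x - (+ 2 * q + 1ℤ))) (≡.cong +_ (≡.sym p≡5+M))
        (far-from-mean M (E-trit a) E≢-1 x (ModN.mod-trans n x≡X X≡E))

  -- Each of the seven non-identity elements of A contributes at least `25 * p ^ 2` to the total
  -- deviation, and the identity contributes at least 0.
  175p²≤56p² : P * P * + 25 * (+ 8 - 1ℤ) ℤ.≤ + 56 * (P * P)
  175p²≤56p² = ≡.subst₂ ℤ._≤_ (begin
    ∑ (λ a → B * (torsion 8 a - ⟦ ε ≟ a ⟧))                   ≡⟨ ∑-cong (λ a → split B (torsion 8 a) ⟦ ε ≟ a ⟧) ⟩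
    ∑ (λ a → B * torsion 8 a + ⟦ ε ≟ a ⟧ * - B)               ≡⟨ ∑-+ (λ a → B * torsion 8 a) (λ a → ⟦ ε ≟ a ⟧ * - B) ⟩
    ∑ (λ a → B * torsion 8 a) + ∑ (λ a → ⟦ ε ≟ a ⟧ * - B)     ≡⟨ ≡.cong₂ _+_ (≡.trans (∑-*ˡ B (torsion 8)) (≡.cong (B *_) ∣A∣)) (∑-⟦⟧ ε (λ _ → - B)) ⟩
    B * + 8 + - B                                             ≡⟨ collect B ⟩
    B * (+ 8 - 1ℤ)                                            ∎)
    total-deviation
    (∑-mono v (λ a → indicator-bound (a ^ 8 ≟ ε) (ε ≟ a) (λ ε≡a → ≡.subst (λ a → a ^ 8 ≡ ε) ε≡a (ε^ 8)) B (deviation a)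
      fibreSum-deviates (0≤square (+ 4 * fibreSum E a - w))))
    where
    open ≡.≡-Reasoning
    B = P * P * + 25
    split : ∀ B t d → B * (t - d) ≡ B * t + d * - B
    split = solve-∀
    collect : ∀ B → B * + 8 + - B ≡ B * (+ 8 - 1ℤ)
    collect = solve-∀

  absurd : ⊥
  absurd = contradiction (ℕₚ.*-cancelʳ-≤ 175 56 (p ℕ.* p) (ℤₚ.drop‿+≤+ (≡.subst₂ ℤ._≤_ lhs rhs 175p²≤56p²))) (ℕₚ.<⇒≱ (ℕₚ.m≤m+n 57 118))
    where
    instance
      p≢0 : NonZero p
      p≢0 = prime⇒nonZero prime-p
      pp≢0 : NonZero (p ℕ.* p)
      pp≢0 = ℕₚ.m*n≢0 p p
    collect : ∀ q → q * + 25 * (+ 8 - 1ℤ) ≡ + 175 * q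
    collect = solve-∀
    lhs : P * P * + 25 * (+ 8 - 1ℤ) ≡ + (175 ℕ.* (p ℕ.* p))
    lhs = ≡.trans (≡.cong (λ q → q * + 25 * (+ 8 - 1ℤ)) (≡.sym (ℤₚ.pos-* p p))) (≡.trans (collect (+ (p ℕ.* p))) (≡.sym (ℤₚ.pos-* 175 (p ℕ.* p))))
    rhs : + 56 * (P * P) ≡ + (56 ℕ.* (p ℕ.* p))
    rhs = ≡.trans (≡.cong (+ 56 *_) (≡.sym (ℤₚ.pos-* p p))) (≡.sym (ℤₚ.pos-* 56 (p ℕ.* p)))

theorem2 : (p : ℕ) → Prime p → 5 ℕ.≤ p →
    (G : FiniteAbelianGroup (8 ℕ.* p ℕ.^ 3)) → (D : Subset (8 ℕ.* p ℕ.^ 3)) →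
    ¬ IsRegularPDS G D (4 ℕ.* p ℕ.^ 2 ℕ.+ 2 ℕ.* p ℕ.+ 1) (2 ℕ.* p ℕ.+ 4) (2 ℕ.* p ℕ.+ 2)
theorem2 p prime-p 5≤p G D pds =
  let M , 5+M≡p     = ℕₚ.m≤n⇒∃[o]m+o≡n 5≤p
      r , p≡1+2r    = odd⇒suc-double p 2∤p
      j , [1+2r]²≡  = odd-square r
  in Contradiction.absurd {p} {M} {j} prime-p (≡.sym 5+M≡p) 2∤p (≡.trans (≡.cong (λ n → n ℕ.* n) p≡1+2r) [1+2r]²≡) G D
       (≡.subst (λ l → IsRegularPDS G D (4 ℕ.* p ℕ.^ 2 ℕ.+ 2 ℕ.* p ℕ.+ 1) l (2 ℕ.* p ℕ.+ 2)) (shift (2 ℕ.* p)) pds)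
  where
  2∤p : ¬ (2 ℕᵈ.∣ p)
  2∤p 2∣p = ℕₚ.<⇒≱ (ℕ.s≤s (ℕ.s≤s (ℕ.s≤s ℕ.z≤n))) (ℕₚ.≤-trans 5≤p (ℕₚ.≤-reflexive (≡.sym (prime∣prime⇒≡ prime[2] prime-p 2∣p))))
  shift : ∀ n → n ℕ.+ 4 ≡ 2 ℕ.+ (n ℕ.+ 2)
  shift = ℕ-Solver.solve-∀
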